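{- The monoid $\mathbb{M}_2$ of intervals in the posets $(\mathscr{D}_n,\leq)$, $n\geq 1$, is free, with generators all intervals whose maximal element has the shape $(1,w,1,0,0)$ for some Dyck path $w$ (of any size $\geq 0$), together with the interval $[(1,0,1,0),(1,0,1,0)]$ in $\mathscr{D}_2$.
   Context: A Dyck path of size $n\geq 0$ is a word of length $2n$ in the letters $0,1$ with $n$ letters $1$ and $n$ letters $0$ such that every prefix contains at least as many $1$'s as $0$'s (the height after a prefix is its number of $1$'s minus its number of $0$'s). Let $\mathscr{D}_n$ be the set of Dyck paths of size $n$. A subpath of a Dyck path $w$ is a non-empty sequence $x$ of consecutive letters of $w$ that starts and ends at the same height and stays strictly above that height in between. A subpath $x$ is movable in $w$ if it is immediately preceded in $w$ by the letter $0$ and either $x$ ends at the last letter of $w$ or $x$ is immediately followed in $w$ by the letter $1$. For a movable subpath $x$, let $N=N(w,x)\geq 1$ be the number of consecutive letters $0$ just before $x$, so $w=a\,0^{N}\,x\,b$ where $a$ does not end with $0$; for $1\leq i\leq N$ let $M(w,x,i)=a\,0^{N-i}\,x\,0^{i}\,b\in\mathscr{D}_n$. Let $\Gamma_n$ be the directed graph on $\mathscr{D}_n$ with edges $w\to M(w,x,i)$ for all movable $x$ in $w$ and all $1\leq i\leq N(w,x)$. The dexter order is: $u\leq v$ if and only if there is a directed path (possibly of length $0$) from $u$ to $v$ in $\Gamma_n$. This is a partial order whose cover relations are exactly the edges of $\Gamma_n$. Product $\sharp$ on non-empty Dyck paths: for a non-empty Dyck path $w$, let $\overline{w}$ be the word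 obtained by removing its first and last letters (a pseudo-Dyck path; its height, starting at $0$, may reach $-1$). For pseudo-Dyck paths $p,q$, write $p=(p',0^k)$ where $p'$ is empty (if $p$ is empty) or ends with $1$, and $q=q'q''$ where $q'$ is the largest prefix of $q$ in which the height stays $\geq 0$; set $p\ast q=(p',q',0^k,q'')$. Then $u\,\sharp\,v=(1,\overline{u}\ast\overline{v},0)$. This is associative with unit $(1,0)$; if $u\in\mathscr{D}_m$ and $v\in\mathscr{D}_n$ then $u\,\sharp\,v\in\mathscr{D}_{m+n-1}$. Monoid $\mathbb{M}_2$: its elements are all intervals $[w,w']$ (i.e. pairs $w\leq w'$ in $\mathscr{D}_n$) for all $n\geq 1$, with product $[w_1,w_1']\,\sharp\,[w_2,w_2']=[w_1\,\sharp\,w_2,\;w_1'\,\sharp\,w_2']$, which is well defined since $w_1\leq w_1'$ and $w_2\leq w_2'$ imply $w_1\,\sharp\,w_2\leq w_1'\,\sharp\,w_2'$. Its unit is the unique interval in $\mathscr{D}_1$. -}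

module Defs where

open import Algebra.Bundles using (Monoid; RawMonoid)
open import Algebra.Morphism.Structures using (module MonoidMorphisms)
import Algebra.Solver.Monoid as MonoidSolver
open import Data.Integer.Base as ℤ using (ℤ; _⊖_; 0ℤ)
import Data.Integer.Properties as ℤ
open import Data.List.Base
  using (List; []; _∷_; _++_; _∷ʳ_; replicate; inits; take; drop; length; foldr; initLast; _∷ʳ′_)
open import Data.List.Properties using (++-assoc; ++-identityʳ; ++-monoid; length-++; ∷-injectiveʳ; ∷ʳ-injectiveʳ)
open import Data.List.Relation.Binary.Pointwise using (Pointwise)
open import Data.List.Relation.Unary.All as All using (All; []; _∷_)
import Data.List.Relation.Unary.All.Properties as All
open import Data.Nat.Base using (ℕ; zero; suc; _+_; _∸_; _≤_; _<_; z≤n; s≤s; s≤s⁻¹)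
open import Data.Nat.Properties
  using (+-suc; +-comm; +-assoc; +-identityʳ; ≤-trans; ≤-reflexive; m≤n+m; m+n∸n≡m;
         m∸n+n≡m; suc-injective; ≰⇒>; ≮⇒≥; ≤-antisym; _≤?_)
open import Data.Product.Base using (Σ; ∃; ∃₂; _×_; _,_; proj₁; proj₂; map₁)
open import Data.Sum.Base using (_⊎_; inj₁; inj₂)
open import Level using (Level; _⊔_)
open import Relation.Binary.Construct.Closure.ReflexiveTransitive using (Star; ε; _◅_; _◅◅_; gmap)
open import Relation.Binary.PropositionalEquality
open import Relation.Nullary.Decidable.Core using (yes; no)
open import Relation.Nullary.Negation using (contradiction)
open import Relation.Unary using (Pred)

data Letter : Set where
  𝟎 𝟏 : Letter

Word : Set
Word = List Letter

infix 8 𝟎^_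

𝟎^_ : ℕ → Word
𝟎^ n = replicate n 𝟎

#𝟏 : Word → ℕ
#𝟏 []      = 0
#𝟏 (𝟏 ∷ w) = suc (#𝟏 w)
#𝟏 (𝟎 ∷ w) = #𝟏 w

#𝟎 : Word → ℕ
#𝟎 []      = 0
#𝟎 (𝟏 ∷ w) = #𝟎 w
#𝟎 (𝟎 ∷ w) = suc (#𝟎 w)

height : Word → ℤ
height w = #𝟏 w ⊖ #𝟎 w

record Dyck (n : ℕ) : Set where
  constructor dyck
  field
    word       : Word
    #𝟏-word    : #𝟏 word ≡ n
    #𝟎-word    : #𝟎 word ≡ n
    dominating : All (λ p → #𝟎 p ≤ #𝟏 p) (inits word)

open Dyck public using (word)

-- A subpath is an occurrence of the factor x directly after the prefix a.
record IsSubpath (a x : Word) : Set where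
  field
    nonEmpty    : x ≢ []
    sameHeight  : height (a ++ x) ≡ height a
    staysHigher : ∀ y z → x ≡ y ++ z → y ≢ [] → z ≢ [] →
                  height a ℤ.< height (a ++ y)

-- The decomposition w = a 0ᴺ x b around a movable subpath x.
record Movable (w : Word) : Set where
  field
    a x b    : Word
    N        : ℕ
    w≡       : w ≡ a ++ 𝟎^ N ++ x ++ b
    subpath  : IsSubpath (a ++ 𝟎^ N) x
    1≤N      : 1 ≤ N
    N-max    : ∀ c → a ≢ c ∷ʳ 𝟎
    followed : b ≡ [] ⊎ ∃ λ c → b ≡ 𝟏 ∷ c

  M : ℕ → Word
  M i = a ++ 𝟎^ (N ∸ i) ++ x ++ 𝟎^ i ++ b

infix 4 _⟶_ _≼_

_⟶_ : ∀ {n} → Dyck n → Dyck n → Set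
u ⟶ v = Σ (Movable (word u)) λ m → ∃ λ i →
        1 ≤ i × i ≤ Movable.N m × word v ≡ Movable.M m i

_≼_ : ∀ {n} → Dyck n → Dyck n → Set
_≼_ = Star _⟶_

-- w without its first and last letters
inner : Word → Word
inner w = take (length w ∸ 2) (drop 1 w)

pushZero : Word × ℕ → Word × ℕ
pushZero ([]     , k) = [] , suc k
pushZero (l ∷ p′ , k) = 𝟎 ∷ l ∷ p′ , k

-- splitTrailing p = (p′ , k), where p = p′ 0ᵏ with k maximal.
splitTrailing : Word → Word × ℕ
splitTrailing []      = [] , 0
splitTrailing (𝟏 ∷ p) = map₁ (𝟏 ∷_) (splitTrailing p)
splitTrailing (𝟎 ∷ p) = pushZero (splitTrailing p)

-- splitFloor h q = (q′ , q″), where q = q′ q″ and q′ is the largest prefix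
-- of q along which the height, starting from h, stays nonnegative.
splitFloor : ℕ → Word → Word × Word
splitFloor h       []      = [] , []
splitFloor h       (𝟏 ∷ q) = map₁ (𝟏 ∷_) (splitFloor (suc h) q)
splitFloor zero    (𝟎 ∷ q) = [] , 𝟎 ∷ q
splitFloor (suc h) (𝟎 ∷ q) = map₁ (𝟎 ∷_) (splitFloor h q)

infixl 6 _✶_ _♯ʷ_

_✶_ : Word → Word → Word
p ✶ q =
  let p′ , k  = splitTrailing p
      q′ , q″ = splitFloor 0 q
  in p′ ++ q′ ++ 𝟎^ k ++ q″

_♯ʷ_ : Word → Word → Word
u ♯ʷ v = 𝟏 ∷ (inner u ✶ inner v) ∷ʳ 𝟎

-- Path h w k: reading w from height h ends at height k, never below 0.
data Path : ℕ → Word → ℕ → Set where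
  nil  : ∀ {h} → Path h [] h
  up   : ∀ {h w k} → Path (suc h) w k → Path h (𝟏 ∷ w) k
  down : ∀ {h w k} → Path h w k → Path (suc h) (𝟎 ∷ w) k

infixr 5 _⊙_

_⊙_ : ∀ {h u k v l} → Path h u k → Path k v l → Path h (u ++ v) l
nil    ⊙ q = q
up p   ⊙ q = up (p ⊙ q)
down p ⊙ q = down (p ⊙ q)

splitP : ∀ u {h v l} → Path h (u ++ v) l → ∃ λ k → Path h u k × Path k v l
splitP []      p        = _ , nil , p
splitP (𝟏 ∷ u) (up p)   = let k , a , b = splitP u p in k , up a , b
splitP (𝟎 ∷ u) (down p) = let k , a , b = splitP u p in k , down a , b

det : ∀ {h u k l} → Path h u k → Path h u l → k ≡ l
det nil      nil      = refl
det (up p)   (up q)   = det p q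
det (down p) (down q) = det p q

lift : ∀ j {h u k} → Path h u k → Path (h + j) u (k + j)
lift j nil      = nil
lift j (up p)   = up (lift j p)
lift j (down p) = down (lift j p)

dropPrefix : ∀ {h u k v l} → Path h u k → Path h (u ++ v) l → Path k v l
dropPrefix {u = u} p q with splitP u q
... | k , a , b = subst (λ h → Path h _ _) (det a p) b

zerosP : ∀ n {h} → Path (n + h) (𝟎^ n) h
zerosP zero    = nil
zerosP (suc n) = down (zerosP n)

zerosP⁻ : ∀ n {k v l} → Path k (𝟎^ n ++ v) l → ∃ λ h → k ≡ n + h × Path h v l
zerosP⁻ zero    p        = _ , refl , p
zerosP⁻ (suc n) (down p) = let h , e , q = zerosP⁻ n p in h , cong suc e , q

factorP : ∀ {h d} → Path 0 d 0 → Path h (𝟏 ∷ d ++ 𝟎 ∷ []) h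
factorP {h} p = up (lift (suc h) p ⊙ down nil)

factorP⊙ : ∀ {h d v l} → Path 0 d 0 → Path h v l → Path h (𝟏 ∷ d ++ 𝟎 ∷ v) l
factorP⊙ {h} p q = up (lift (suc h) p ⊙ down q)

factorP⁻ : ∀ {h d v l} → Path 0 d 0 → Path h (𝟏 ∷ d ++ 𝟎 ∷ v) l → Path h v l
factorP⁻ {h} p (up q) with dropPrefix (lift (suc h) p) q
... | down r = r

insertP : ∀ s {h z l q} → Path 0 q 0 → Path h (s ++ 𝟏 ∷ z) l → Path h (s ++ 𝟏 ∷ q ++ z) l
insertP []      {h} pq (up p)   = up (lift (suc h) pq ⊙ p)
insertP (𝟏 ∷ s)     pq (up p)   = up (insertP s pq p)
insertP (𝟎 ∷ s)     pq (down p) = down (insertP s pq p)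

toPath′ : ∀ h w → All (λ p → #𝟎 p ≤ h + #𝟏 p) (inits w) → h + #𝟏 w ≡ #𝟎 w → Path h w 0
toPath′ h []      _ e with refl ← trans (sym (+-identityʳ h)) e = nil
toPath′ h (𝟏 ∷ w) (_ ∷ _ ∷ ps) e =
  up (toPath′ (suc h) w
    (z≤n ∷ All.map (λ {p} q → ≤-trans q (≤-reflexive (+-suc h (#𝟏 p)))) (All.map⁻ ps))
    (trans (sym (+-suc h (#𝟏 w))) e))
toPath′ zero    (𝟎 ∷ w) (_ ∷ () ∷ ps) e
toPath′ (suc h) (𝟎 ∷ w) (_ ∷ _ ∷ ps) e =
  down (toPath′ h w (z≤n ∷ All.map s≤s⁻¹ (All.map⁻ ps)) (suc-injective e))

toPath : ∀ {n} (u : Dyck n) → Path 0 (word u) 0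
toPath (dyck w e f d) = toPath′ 0 w d (trans e (sym f))

prefixesP : ∀ {h w k} → Path h w k → All (λ p → #𝟎 p ≤ h + #𝟏 p) (inits w)
prefixesP nil = z≤n ∷ []
prefixesP {h} (up p) with prefixesP p
... | _ ∷ ps = z≤n ∷ z≤n ∷
  All.map⁺ (All.map (λ {q} r → ≤-trans r (≤-reflexive (sym (+-suc h (#𝟏 q))))) ps)
prefixesP (down p) with prefixesP p
... | _ ∷ ps = z≤n ∷ s≤s z≤n ∷ All.map⁺ (All.map s≤s ps)

balanceP : ∀ {h w k} → Path h w k → h + #𝟏 w ≡ k + #𝟎 w
balanceP nil = refl
balanceP {h} {𝟏 ∷ w} (up p) = trans (+-suc h (#𝟏 w)) (balanceP p)
balanceP {k = k} (down {w = w} p) = trans (cong suc (balanceP p)) (sym (+-suc k (#𝟎 w)))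

fromPath : ∀ {n} w → Path 0 w 0 → #𝟏 w ≡ n → Dyck n
fromPath w p e = dyck w e (trans (sym (balanceP p)) e) (prefixesP p)

lastPeak : ∀ {h w} → Path h w 0 → w ≡ 𝟎^ h ⊎ ∃₂ λ s k → w ≡ s ++ 𝟏 ∷ 𝟎^ (suc k)
lastPeak nil = inj₁ refl
lastPeak {h} (up p) with lastPeak p
... | inj₁ refl           = inj₂ ([] , h , refl)
... | inj₂ (s , k , refl) = inj₂ (𝟏 ∷ s , k , refl)
lastPeak (down p) with lastPeak p
... | inj₁ refl           = inj₁ refl
... | inj₂ (s , k , refl) = inj₂ (𝟎 ∷ s , k , refl)

lower : ∀ {h c k} → Path (suc h) c k →
        (∃₂ λ q r → c ≡ q ++ 𝟎 ∷ r × Path h q 0 × Path 0 r k) ⊎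
        (∃ λ k′ → k ≡ suc k′ × Path h c k′)
lower nil = inj₂ (_ , refl , nil)
lower (up p) with lower p
... | inj₁ (q , r , refl , a , b) = inj₁ (𝟏 ∷ q , r , refl , up a , b)
... | inj₂ (k′ , refl , a)        = inj₂ (k′ , refl , up a)
lower {zero} (down {w = w} p) = inj₁ ([] , w , refl , nil , p)
lower {suc h} (down p) with lower p
... | inj₁ (q , r , refl , a , b) = inj₁ (𝟎 ∷ q , r , refl , down a , b)
... | inj₂ (k′ , refl , a)        = inj₂ (k′ , refl , down a)

firstReturn : ∀ {h c} → Path (suc h) c 0 →
              ∃₂ λ q r → c ≡ q ++ 𝟎 ∷ r × Path h q 0 × Path 0 r 0
firstReturn p with lower p
... | inj₁ x            = x
... | inj₂ (k′ , () , a)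

peak : ∀ {n} (u : Dyck (suc n)) → ∃₂ λ s k → word u ≡ s ++ 𝟏 ∷ 𝟎^ (suc k)
peak u with word u | Dyck.#𝟏-word u | lastPeak (toPath u)
... | _ | () | inj₁ refl
... | _ | _  | inj₂ (s , k , e) = s , k , e

return : ∀ {n} (v : Dyck (suc n)) →
         ∃₂ λ q r → word v ≡ 𝟏 ∷ q ++ 𝟎 ∷ r × Path 0 q 0 × Path 0 r 0
return v with word v | Dyck.#𝟏-word v | toPath v
... | _ | () | nil
... | _ | _  | up p with firstReturn p
...   | q , r , refl , a , b = q , r , refl , a , b

zeros-∷ : ∀ k r → 𝟎^ k ++ 𝟎 ∷ r ≡ 𝟎 ∷ 𝟎^ k ++ r
zeros-∷ zero    r = refl
zeros-∷ (suc k) r = cong (𝟎 ∷_) (zeros-∷ k r)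

zeros-++ : ∀ j k r → 𝟎^ (j + k) ++ r ≡ 𝟎^ j ++ 𝟎^ k ++ r
zeros-++ zero    k r = refl
zeros-++ (suc j) k r = cong (𝟎 ∷_) (zeros-++ j k r)

inner-∷ʳ : ∀ l p l′ → inner (l ∷ p ++ l′ ∷ []) ≡ p
inner-∷ʳ l p l′ = go p (trans (cong (_∸ 1) (length-++ p)) (m+n∸n≡m (length p) 1))
  where
  go : ∀ {n} p → n ≡ length p → take n (p ++ l′ ∷ []) ≡ p
  go []      refl = refl
  go (x ∷ p) refl = cong (x ∷_) (go p refl)

pushZero-∷ʳ : ∀ s k → pushZero (s ∷ʳ 𝟏 , k) ≡ (𝟎 ∷ s ∷ʳ 𝟏 , k)
pushZero-∷ʳ []      k = refl
pushZero-∷ʳ (_ ∷ _) k = refl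

splitTrailing-zeros : ∀ k → splitTrailing (𝟎^ k) ≡ ([] , k)
splitTrailing-zeros zero    = refl
splitTrailing-zeros (suc k) = cong pushZero (splitTrailing-zeros k)

splitTrailing-peak : ∀ s k → splitTrailing (s ++ 𝟏 ∷ 𝟎^ k) ≡ (s ∷ʳ 𝟏 , k)
splitTrailing-peak []      k = cong (map₁ (𝟏 ∷_)) (splitTrailing-zeros k)
splitTrailing-peak (𝟏 ∷ s) k = cong (map₁ (𝟏 ∷_)) (splitTrailing-peak s k)
splitTrailing-peak (𝟎 ∷ s) k = trans (cong pushZero (splitTrailing-peak s k)) (pushZero-∷ʳ s k)

splitFloor-++ : ∀ {h q r} → Path h q 0 → splitFloor 0 r ≡ ([] , r) → splitFloor h (q ++ r) ≡ (q , r)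
splitFloor-++ nil      e = e
splitFloor-++ (up p)   e = cong (map₁ (𝟏 ∷_)) (splitFloor-++ p e)
splitFloor-++ (down p) e = cong (map₁ (𝟎 ∷_)) (splitFloor-++ p e)

leftFactor : ∀ s k → Path 0 (s ++ 𝟏 ∷ 𝟎^ (suc k)) 0 →
  ∃ λ s′ → splitTrailing (inner (s ++ 𝟏 ∷ 𝟎^ (suc k))) ≡ (s′ , k) × 𝟏 ∷ s′ ≡ s ∷ʳ 𝟏
leftFactor [] zero    p = [] , refl , refl
leftFactor [] (suc k) (up (down ()))
leftFactor (𝟏 ∷ s) k p = s ∷ʳ 𝟏 , trans (cong splitTrailing e) (splitTrailing-peak s k) , refl
  where
  e : inner (𝟏 ∷ s ++ 𝟏 ∷ 𝟎^ (suc k)) ≡ s ++ 𝟏 ∷ 𝟎^ k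
  e = trans (cong inner (cong (𝟏 ∷_)
        (trans (cong (λ z → s ++ 𝟏 ∷ z)
                 (trans (sym (++-identityʳ (𝟎^ (suc k)))) (sym (zeros-∷ k []))))
               (sym (++-assoc s (𝟏 ∷ 𝟎^ k) (𝟎 ∷ []))))))
      (inner-∷ʳ 𝟏 (s ++ 𝟏 ∷ 𝟎^ k) 𝟎)

rightFactor : ∀ q r → Path 0 q 0 → Path 0 r 0 →
  ∃ λ q″ → splitFloor 0 (inner (𝟏 ∷ q ++ 𝟎 ∷ r)) ≡ (q , q″) × q″ ∷ʳ 𝟎 ≡ 𝟎 ∷ r
rightFactor q r pq pr with initLast r
... | [] = [] , trans (cong (splitFloor 0) (trans (inner-∷ʳ 𝟏 q 𝟎) (sym (++-identityʳ q))))
                      (splitFloor-++ pq refl) , refl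
... | r′ ∷ʳ′ 𝟎 = 𝟎 ∷ r′ ,
  trans (cong (splitFloor 0)
          (trans (cong (λ z → inner (𝟏 ∷ z)) (sym (++-assoc q (𝟎 ∷ r′) (𝟎 ∷ []))))
                 (inner-∷ʳ 𝟏 (q ++ 𝟎 ∷ r′) 𝟎)))
        (splitFloor-++ pq refl) , refl
... | r′ ∷ʳ′ 𝟏 with splitP r′ pr
...   | _ , _ , up ()

-- The last peak s 1 0ᵏ⁺¹ of u and the first return 1 q 0 r of v determine u ♯ v.
♯ʷ-shape : ∀ s k q r → Path 0 (s ++ 𝟏 ∷ 𝟎^ (suc k)) 0 → Path 0 q 0 → Path 0 r 0 →
  (s ++ 𝟏 ∷ 𝟎^ (suc k)) ♯ʷ (𝟏 ∷ q ++ 𝟎 ∷ r) ≡ s ++ 𝟏 ∷ q ++ 𝟎^ (suc k) ++ r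
♯ʷ-shape s k q r ps pq pr with leftFactor s k ps | rightFactor q r pq pr
... | s′ , e₁ , f₁ | q″ , e₂ , f₂ rewrite e₁ | e₂ = begin
  (𝟏 ∷ s′ ++ q ++ 𝟎^ k ++ q″) ++ 𝟎 ∷ []
    ≡⟨ solve 5 (λ a b c d e → (a ⊕ b ⊕ c ⊕ d) ⊕ e ⊜ a ⊕ b ⊕ c ⊕ (d ⊕ e)) refl
         (𝟏 ∷ s′) q (𝟎^ k) q″ (𝟎 ∷ []) ⟩
  (𝟏 ∷ s′) ++ q ++ 𝟎^ k ++ (q″ ++ 𝟎 ∷ [])
    ≡⟨ cong₂ (λ a b → a ++ q ++ 𝟎^ k ++ b) f₁ f₂ ⟩
  (s ++ 𝟏 ∷ []) ++ q ++ 𝟎^ k ++ 𝟎 ∷ r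
    ≡⟨ ++-assoc s (𝟏 ∷ []) _ ⟩
  s ++ 𝟏 ∷ q ++ 𝟎^ k ++ 𝟎 ∷ r
    ≡⟨ cong (λ z → s ++ 𝟏 ∷ q ++ z) (zeros-∷ k r) ⟩
  s ++ 𝟏 ∷ q ++ 𝟎 ∷ 𝟎^ k ++ r ∎
  where
  open ≡-Reasoning
  open MonoidSolver (++-monoid Letter)

#𝟏-++ : ∀ u v → #𝟏 (u ++ v) ≡ #𝟏 u + #𝟏 v
#𝟏-++ []      v = refl
#𝟏-++ (𝟏 ∷ u) v = cong suc (#𝟏-++ u v)
#𝟏-++ (𝟎 ∷ u) v = #𝟏-++ u v

#𝟎-++ : ∀ u v → #𝟎 (u ++ v) ≡ #𝟎 u + #𝟎 v
#𝟎-++ []      v = refl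
#𝟎-++ (𝟏 ∷ u) v = #𝟎-++ u v
#𝟎-++ (𝟎 ∷ u) v = cong suc (#𝟎-++ u v)

#𝟏-zeros : ∀ k → #𝟏 (𝟎^ k) ≡ 0
#𝟏-zeros zero    = refl
#𝟏-zeros (suc k) = #𝟏-zeros k

shapeP : ∀ s k q r → Path 0 (s ++ 𝟏 ∷ 𝟎^ (suc k)) 0 → Path 0 q 0 → Path 0 r 0 →
         Path 0 (s ++ 𝟏 ∷ q ++ 𝟎^ (suc k) ++ r) 0
shapeP s k q r ps pq pr = subst (λ w → Path 0 w 0)
  (solve 5 (λ a o b c d → (a ⊕ o ⊕ b ⊕ c) ⊕ d ⊜ a ⊕ o ⊕ b ⊕ c ⊕ d) refl
     s (𝟏 ∷ []) q (𝟎^ (suc k)) r)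
  (insertP s pq ps ⊙ pr)
  where open MonoidSolver (++-monoid Letter)

♯ʷ-path : ∀ {m n} (u : Dyck (suc m)) (v : Dyck (suc n)) → Path 0 (word u ♯ʷ word v) 0
♯ʷ-path u v with word u | peak u | toPath u | word v | return v
... | _ | s , k , refl | pu | _ | q , r , refl , pq , pr =
  subst (λ w → Path 0 w 0) (sym (♯ʷ-shape s k q r pu pq pr)) (shapeP s k q r pu pq pr)

shape-#𝟏 : ∀ s z q r → suc (#𝟏 (s ++ 𝟏 ∷ q ++ z ++ r)) ≡ #𝟏 (s ++ 𝟏 ∷ z) + #𝟏 (𝟏 ∷ q ++ 𝟎 ∷ r)
shape-#𝟏 (𝟏 ∷ s) z q r = cong suc (shape-#𝟏 s z q r)
shape-#𝟏 (𝟎 ∷ s) z q r = shape-#𝟏 s z q r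
shape-#𝟏 [] z q r = cong suc (begin
  suc (#𝟏 (q ++ z ++ r))           ≡⟨ cong suc (#𝟏-++ q (z ++ r)) ⟩
  suc (#𝟏 q + #𝟏 (z ++ r))         ≡⟨ cong (λ x → suc (#𝟏 q + x)) (#𝟏-++ z r) ⟩
  suc (#𝟏 q + (#𝟏 z + #𝟏 r))       ≡⟨ cong suc (sym (+-assoc (#𝟏 q) (#𝟏 z) (#𝟏 r))) ⟩
  suc (#𝟏 q + #𝟏 z + #𝟏 r)         ≡⟨ cong (λ x → suc (x + #𝟏 r)) (+-comm (#𝟏 q) (#𝟏 z)) ⟩
  suc (#𝟏 z + #𝟏 q + #𝟏 r)         ≡⟨ cong suc (+-assoc (#𝟏 z) (#𝟏 q) (#𝟏 r)) ⟩
  suc (#𝟏 z + (#𝟏 q + #𝟏 r))       ≡⟨ sym (+-suc (#𝟏 z) _) ⟩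
  #𝟏 z + suc (#𝟏 q + #𝟏 r)         ≡⟨ cong (λ x → #𝟏 z + suc x) (sym (#𝟏-++ q (𝟎 ∷ r))) ⟩
  #𝟏 z + suc (#𝟏 (q ++ 𝟎 ∷ r))     ∎)
  where open ≡-Reasoning

♯ʷ-#𝟏 : ∀ {m n} (u : Dyck (suc m)) (v : Dyck (suc n)) → #𝟏 (word u ♯ʷ word v) ≡ suc (m + n)
♯ʷ-#𝟏 {m} {n} u v
  with word u | Dyck.#𝟏-word u | peak u | toPath u | word v | Dyck.#𝟏-word v | return v
... | _ | cu | s , k , refl | pu | _ | cv | q , r , refl , pq , pr =
  suc-injective (trans (cong (λ w → suc (#𝟏 w)) (♯ʷ-shape s k q r pu pq pr))
    (trans (shape-#𝟏 s (𝟎^ (suc k)) q r)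
      (trans (cong₂ _+_ cu cv) (cong suc (+-suc m n)))))

infixl 6 _♯_

_♯_ : ∀ {m n} → Dyck (suc m) → Dyck (suc n) → Dyck (suc (m + n))
u ♯ v = fromPath (word u ♯ʷ word v) (♯ʷ-path u v) (♯ʷ-#𝟏 u v)

Followed : Word → Set
Followed b = b ≡ [] ⊎ ∃ λ c → b ≡ 𝟏 ∷ c

-- The move by i + 1 of x = 1 d 0, where N = j + i + 1 and a = c 1; on Dyck
-- paths this is the relation _⟶_ on underlying words.
data Edge : Word → Word → Set where
  edge : ∀ c j i d b → Path 0 d 0 → Followed b →
         Edge (c ++ 𝟏 ∷ 𝟎^ (j + suc i) ++ 𝟏 ∷ d ++ 𝟎 ∷ b)
              (c ++ 𝟏 ∷ 𝟎^ j ++ 𝟏 ∷ d ++ 𝟎 ∷ 𝟎^ (suc i) ++ b)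

edgeP : ∀ {w w′} → Edge w w′ → Path 0 w 0 → Path 0 w′ 0
edgeP (edge c j i d b pd _) p with splitP c p
... | h , pc , up p₁ with zerosP⁻ (j + suc i) p₁
... | h₂ , e , p₂ = pc ⊙ up (subst (λ z → Path z (𝟎^ j ++ 𝟏 ∷ d ++ 𝟎 ∷ 𝟎^ (suc i) ++ b) 0) (sym (trans e (+-assoc j (suc i) h₂)))
                      (zerosP j ⊙ factorP⊙ pd (zerosP (suc i) ⊙ factorP⁻ pd p₂)))

followedP : ∀ {r} → Path 0 r 0 → Followed r
followedP nil    = inj₁ refl
followedP (up _) = inj₂ (_ , refl)

followed-++ : ∀ {b c} → Followed b → Followed c → Followed (b ++ c)
followed-++ (inj₁ refl)       f = f
followed-++ (inj₂ (_ , refl)) f = inj₂ (_ , refl)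

height-++ : ∀ u v → height (u ++ v) ≡ height u ℤ.+ height v
height-++ u v = begin
  #𝟏 (u ++ v) ⊖ #𝟎 (u ++ v)           ≡⟨ cong₂ _⊖_ (#𝟏-++ u v) (#𝟎-++ u v) ⟩
  (#𝟏 u + #𝟏 v) ⊖ (#𝟎 u + #𝟎 v)       ≡⟨ ⊖-+ (#𝟏 u) (#𝟎 u) ⟩
  height u ℤ.+ height v               ∎
  where
  open ≡-Reasoning
  ⊖-+ : ∀ m n {o p} → (m + o) ⊖ (n + p) ≡ (m ⊖ n) ℤ.+ (o ⊖ p)
  ⊖-+ zero zero {o} {p} = sym (ℤ.+-identityˡ (o ⊖ p))
  ⊖-+ (suc m) zero {o} {p} = sym (ℤ.distribʳ-⊖-+-pos (suc m) o p)
  ⊖-+ zero (suc n) {o} {p} = sym (ℤ.distribʳ-⊖-+-neg n o p)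
  ⊖-+ (suc m) (suc n) {o} {p} =
    trans (ℤ.[1+m]⊖[1+n]≡m⊖n (m + o) (n + p))
      (trans (⊖-+ m n) (cong (λ z → z ℤ.+ (o ⊖ p)) (sym (ℤ.[1+m]⊖[1+n]≡m⊖n m n))))

higher⁻ : ∀ a y → height a ℤ.< height (a ++ y) → #𝟎 y < #𝟏 y
higher⁻ a y p with suc (#𝟎 y) ≤? #𝟏 y
... | yes q = q
... | no ¬q = contradiction p (ℤ.≤⇒≯ (begin
  height (a ++ y)               ≡⟨ height-++ a y ⟩
  height a ℤ.+ height y         ≤⟨ ℤ.+-monoʳ-≤ (height a) (ℤ.⊖-monoˡ-≤ (#𝟎 y) (s≤s⁻¹ (≰⇒> ¬q))) ⟩
  height a ℤ.+ (#𝟎 y ⊖ #𝟎 y)    ≡⟨ cong (λ z → height a ℤ.+ z) (ℤ.n⊖n≡0 (#𝟎 y)) ⟩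
  height a ℤ.+ 0ℤ               ≡⟨ ℤ.+-identityʳ (height a) ⟩
  height a                      ∎))
  where open ℤ.≤-Reasoning

higher : ∀ a y → #𝟎 y < #𝟏 y → height a ℤ.< height (a ++ y)
higher a y p = begin-strict
  height a                      ≡⟨ ℤ.+-identityʳ (height a) ⟨
  height a ℤ.+ 0ℤ               ≡⟨ cong (λ z → height a ℤ.+ z) (ℤ.n⊖n≡0 (#𝟎 y)) ⟨
  height a ℤ.+ (#𝟎 y ⊖ #𝟎 y)    <⟨ ℤ.+-monoʳ-< (height a) (ℤ.⊖-monoˡ-< (#𝟎 y) p) ⟩
  height a ℤ.+ height y         ≡⟨ height-++ a y ⟨
  height (a ++ y)               ∎
  where open ℤ.≤-Reasoning

same : ∀ a x → #𝟏 x ≡ #𝟎 x → height (a ++ x) ≡ height a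
same a x e = trans (height-++ a x) (trans (cong (λ z → height a ℤ.+ z)
  (trans (cong (_⊖ #𝟎 x) e) (ℤ.n⊖n≡0 (#𝟎 x)))) (ℤ.+-identityʳ (height a)))

same⁻ : ∀ a x → height (a ++ x) ≡ height a → #𝟏 x ≡ #𝟎 x
same⁻ a x e = ≤-antisym
  (≮⇒≥ λ p → ℤ.<-irrefl (sym e) (higher a x p))
  (≮⇒≥ λ p → ℤ.<-irrefl e (lower′ p))
  where
  lower′ : #𝟏 x < #𝟎 x → height (a ++ x) ℤ.< height a
  lower′ p = begin-strict
    height (a ++ x)               ≡⟨ height-++ a x ⟩
    height a ℤ.+ height x         <⟨ ℤ.+-monoʳ-< (height a) (ℤ.⊖-monoˡ-< (#𝟎 x) p) ⟩
    height a ℤ.+ (#𝟎 x ⊖ #𝟎 x)    ≡⟨ cong (λ z → height a ℤ.+ z) (ℤ.n⊖n≡0 (#𝟎 x)) ⟩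
    height a ℤ.+ 0ℤ               ≡⟨ ℤ.+-identityʳ (height a) ⟩
    height a                      ∎
    where open ℤ.≤-Reasoning

primeShape : ∀ h z → z ≢ [] → suc h + #𝟏 z ≡ #𝟎 z →
  (∀ y t → z ≡ y ++ t → y ≢ [] → t ≢ [] → #𝟎 y < suc h + #𝟏 y) →
  ∃ λ d → z ≡ d ∷ʳ 𝟎 × Path h d 0
primeShape h [] z≢ _ _ = contradiction refl z≢
primeShape h (𝟏 ∷ []) _ () _
primeShape zero    (𝟎 ∷ []) _ e _ = [] , refl , nil
primeShape (suc h) (𝟎 ∷ []) _ () _
primeShape h (𝟏 ∷ l ∷ z) _ e f =
  let d , e′ , p = primeShape (suc h) (l ∷ z) (λ ()) (trans (sym (+-suc (suc h) _)) e)
        (λ y t g y≢ t≢ → ≤-trans (f (𝟏 ∷ y) t (cong (𝟏 ∷_) g) (λ ()) t≢)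
                           (≤-reflexive (+-suc (suc h) (#𝟏 y))))
  in 𝟏 ∷ d , cong (𝟏 ∷_) e′ , up p
primeShape zero (𝟎 ∷ l ∷ z) _ e f with f (𝟎 ∷ []) (l ∷ z) refl (λ ()) (λ ())
... | s≤s ()
primeShape (suc h) (𝟎 ∷ l ∷ z) _ e f =
  let d , e′ , p = primeShape h (l ∷ z) (λ ()) (suc-injective e)
        (λ y t g y≢ t≢ → s≤s⁻¹ (f (𝟎 ∷ y) t (cong (𝟎 ∷_) g) (λ ()) t≢))
  in 𝟎 ∷ d , cong (𝟎 ∷_) e′ , down p

subpathShape : ∀ {a x} → IsSubpath a x → ∃ λ d → x ≡ 𝟏 ∷ d ∷ʳ 𝟎 × Path 0 d 0
subpathShape {a} {x} sub = go x nonEmpty (same⁻ a x sameHeight)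
    (λ y t e y≢ t≢ → higher⁻ a y (staysHigher y t e y≢ t≢))
  where
  open IsSubpath sub
  go : ∀ x → x ≢ [] → #𝟏 x ≡ #𝟎 x →
       (∀ y t → x ≡ y ++ t → y ≢ [] → t ≢ [] → #𝟎 y < #𝟏 y) →
       ∃ λ d → x ≡ 𝟏 ∷ d ∷ʳ 𝟎 × Path 0 d 0
  go [] x≢ _ _ = contradiction refl x≢
  go (𝟏 ∷ []) _ () _
  go (𝟎 ∷ []) _ () _
  go (𝟎 ∷ l ∷ x) _ _ f with f (𝟎 ∷ []) (l ∷ x) refl (λ ()) (λ ())
  ... | ()
  go (𝟏 ∷ l ∷ x) _ e f =
    let d , e′ , p = primeShape 0 (l ∷ x) (λ ()) e
          (λ y t g y≢ t≢ → f (𝟏 ∷ y) t (cong (𝟏 ∷_) g) (λ ()) t≢)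
    in d , cong (𝟏 ∷_) e′ , p

aboveP : ∀ {h d k} y t → Path h d k → d ∷ʳ 𝟎 ≡ y ++ t → t ≢ [] → #𝟎 y ≤ h + #𝟏 y
aboveP [] t _ _ _ = z≤n
aboveP {d = []} (l ∷ []) t p e t≢ with refl ← ∷-injectiveʳ e = contradiction refl t≢
aboveP {d = []} (l ∷ l′ ∷ y) t p e t≢ with () ← ∷-injectiveʳ e
aboveP {h} (𝟏 ∷ y) t (up p) e t≢ =
  ≤-trans (aboveP y t p (∷-injectiveʳ e) t≢) (≤-reflexive (sym (+-suc h (#𝟏 y))))
aboveP (𝟎 ∷ y) t (down p) e t≢ = s≤s (aboveP y t p (∷-injectiveʳ e) t≢)
aboveP (𝟎 ∷ y) t (up p) () t≢
aboveP (𝟏 ∷ y) t (down p) () t≢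

shapeSubpath : ∀ a {d} → Path 0 d 0 → IsSubpath a (𝟏 ∷ d ∷ʳ 𝟎)
shapeSubpath a {d} p = record
  { nonEmpty    = λ ()
  ; sameHeight  = same a _ (balanceP (factorP {0} p))
  ; staysHigher = λ where
      []      t e y≢ t≢ → contradiction refl y≢
      (𝟏 ∷ y) t e y≢ t≢ → higher a (𝟏 ∷ y) (s≤s (aboveP y t p (∷-injectiveʳ e) t≢))
      (𝟎 ∷ y) t () y≢ t≢
  }

toEdge′ : ∀ a x b N i → IsSubpath (a ++ 𝟎^ N) x → (∀ c → a ≢ c ∷ʳ 𝟎) → Followed b →
          suc i ≤ N → Path 0 (a ++ 𝟎^ N ++ x ++ b) 0 →
          Edge (a ++ 𝟎^ N ++ x ++ b) (a ++ 𝟎^ (N ∸ suc i) ++ x ++ 𝟎^ (suc i) ++ b)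
toEdge′ a x b N i sub max fol i<N p with initLast a
... | c ∷ʳ′ 𝟎 = contradiction refl (max c)
toEdge′ .[] x b (suc N) i sub max fol i<N () | []
toEdge′ .(c ∷ʳ 𝟏) x b N i sub max fol i<N p | c ∷ʳ′ 𝟏 with subpathShape sub
... | d , refl , pd = subst₂ Edge
  (trans (cong (λ n → c ++ 𝟏 ∷ 𝟎^ n ++ 𝟏 ∷ d ++ 𝟎 ∷ b) (m∸n+n≡m i<N)) (reassoc (𝟎^ N) b))
  (reassoc (𝟎^ (N ∸ suc i)) (𝟎^ (suc i) ++ b))
  (edge c (N ∸ suc i) i d b pd fol)
  where
  reassoc : ∀ z b → c ++ 𝟏 ∷ z ++ 𝟏 ∷ d ++ 𝟎 ∷ b ≡ (c ∷ʳ 𝟏) ++ z ++ (𝟏 ∷ d ∷ʳ 𝟎) ++ b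
  reassoc z b = solve 6 (λ c o z d e b → c ⊕ o ⊕ z ⊕ (o ⊕ d) ⊕ e ⊕ b ⊜ (c ⊕ o) ⊕ z ⊕ (o ⊕ d ⊕ e) ⊕ b)
                  refl c (𝟏 ∷ []) z d (𝟎 ∷ []) b
    where open MonoidSolver (++-monoid Letter)

toEdge : ∀ {n} {u v : Dyck n} → u ⟶ v → Edge (word u) (word v)
toEdge {u = u} (m , suc i , _ , i≤N , e) = subst₂ Edge (sym w≡) (sym e)
  (toEdge′ a x b N i subpath N-max followed i≤N (subst (λ w → Path 0 w 0) w≡ (toPath u)))
  where open Movable m

fromEdge′ : ∀ {w w′} → Edge w w′ →
            Σ (Movable w) λ m → ∃ λ i → 1 ≤ i × i ≤ Movable.N m × w′ ≡ Movable.M m i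
fromEdge′ (edge c j i d b pd fol) =
  record
    { a        = c ∷ʳ 𝟏
    ; x        = 𝟏 ∷ d ∷ʳ 𝟎
    ; b        = b
    ; N        = j + suc i
    ; w≡       = reassoc (𝟎^ (j + suc i)) b
    ; subpath  = shapeSubpath _ pd
    ; 1≤N      = ≤-trans (s≤s z≤n) (m≤n+m (suc i) j)
    ; N-max    = λ c′ e → contradiction (∷ʳ-injectiveʳ c c′ e) λ ()
    ; followed = fol
    } , suc i , s≤s z≤n , m≤n+m (suc i) j ,
  trans (reassoc (𝟎^ j) (𝟎^ (suc i) ++ b))
    (cong (λ n → (c ∷ʳ 𝟏) ++ 𝟎^ n ++ (𝟏 ∷ d ∷ʳ 𝟎) ++ 𝟎^ (suc i) ++ b) (sym (m+n∸n≡m j (suc i))))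
  where
  reassoc : ∀ z b → c ++ 𝟏 ∷ z ++ 𝟏 ∷ d ++ 𝟎 ∷ b ≡ (c ∷ʳ 𝟏) ++ z ++ (𝟏 ∷ d ∷ʳ 𝟎) ++ b
  reassoc z b = solve 6 (λ c o z d e b → c ⊕ o ⊕ z ⊕ (o ⊕ d) ⊕ e ⊕ b ⊜ (c ⊕ o) ⊕ z ⊕ (o ⊕ d ⊕ e) ⊕ b)
                  refl c (𝟏 ∷ []) z d (𝟎 ∷ []) b
    where open MonoidSolver (++-monoid Letter)

fromEdge : ∀ {n} {u v : Dyck n} → Edge (word u) (word v) → u ⟶ v
fromEdge = fromEdge′

module _ (q r : Word) (pq : Path 0 q 0) (pr : Path 0 r 0) where

  open MonoidSolver (++-monoid Letter)

  edge-♯ʷˡ : ∀ {u u′} → Edge u u′ → Path 0 u 0 →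
             Edge (u ♯ʷ (𝟏 ∷ q ++ 𝟎 ∷ r)) (u′ ♯ʷ (𝟏 ∷ q ++ 𝟎 ∷ r))
  edge-♯ʷˡ E@(edge c j i d b pd fol) pu = go fol (lastPeak pd) (lastPeak (proj₂ (proj₂ (rest pu))))
    where
    N = j + suc i
    u = c ++ 𝟏 ∷ 𝟎^ N ++ 𝟏 ∷ d ++ 𝟎 ∷ b
    u′ = c ++ 𝟏 ∷ 𝟎^ j ++ 𝟏 ∷ d ++ 𝟎 ∷ 𝟎^ (suc i) ++ b
    v = 𝟏 ∷ q ++ 𝟎 ∷ r

    pu′ : Path 0 u′ 0
    pu′ = edgeP E pu

    rest : Path 0 u 0 → ∃ λ h → Path 0 (c ++ 𝟏 ∷ 𝟎^ N ++ 𝟏 ∷ d ∷ʳ 𝟎) h × Path h b 0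
    rest p = splitP (c ++ 𝟏 ∷ 𝟎^ N ++ 𝟏 ∷ d ∷ʳ 𝟎) (subst (λ w → Path 0 w 0)
      (solve 6 (λ c o z d e b → c ⊕ o ⊕ z ⊕ (o ⊕ d) ⊕ e ⊕ b ⊜ (c ⊕ o ⊕ z ⊕ (o ⊕ d ⊕ e)) ⊕ b)
        refl c (𝟏 ∷ []) (𝟎^ N) d (𝟎 ∷ []) b) p)

    value : ∀ {t t′} s k → t ≡ s ++ 𝟏 ∷ 𝟎^ (suc k) → Path 0 t 0 →
            t′ ≡ s ++ 𝟏 ∷ q ++ 𝟎^ (suc k) ++ r → t′ ≡ t ♯ʷ v
    value s k refl p e = trans e (sym (♯ʷ-shape s k q r p pq pr))

    -- the last peak lies after x
    after : ∀ s k → b ≡ s ++ 𝟏 ∷ 𝟎^ (suc k) → Followed b → Edge (u ♯ʷ v) (u′ ♯ʷ v)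
    after s k refl fb = subst₂ Edge
      (value (c ++ 𝟏 ∷ 𝟎^ N ++ 𝟏 ∷ d ++ 𝟎 ∷ s) k (assoc (𝟎^ N) [] (𝟏 ∷ 𝟎^ (suc k)))
        pu (assoc (𝟎^ N) [] (𝟏 ∷ q ++ 𝟎^ (suc k) ++ r)))
      (value (c ++ 𝟏 ∷ 𝟎^ j ++ 𝟏 ∷ d ++ 𝟎 ∷ 𝟎^ (suc i) ++ s) k
        (assoc (𝟎^ j) (𝟎^ (suc i)) (𝟏 ∷ 𝟎^ (suc k)))
        pu′ (assoc (𝟎^ j) (𝟎^ (suc i)) (𝟏 ∷ q ++ 𝟎^ (suc k) ++ r)))
      (edge c j i d (s ++ 𝟏 ∷ q ++ 𝟎^ (suc k) ++ r) pd (fol′ s fb))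
      where
      fol′ : ∀ s {y z} → Followed (s ++ 𝟏 ∷ y) → Followed (s ++ 𝟏 ∷ z)
      fol′ []      _ = inj₂ (_ , refl)
      fol′ (𝟏 ∷ s) _ = inj₂ (_ , refl)
      fol′ (𝟎 ∷ s) (inj₁ ())
      fol′ (𝟎 ∷ s) (inj₂ (_ , ()))

      assoc : ∀ z z′ y → c ++ 𝟏 ∷ z ++ 𝟏 ∷ d ++ 𝟎 ∷ z′ ++ s ++ y ≡
                         (c ++ 𝟏 ∷ z ++ 𝟏 ∷ d ++ 𝟎 ∷ z′ ++ s) ++ y
      assoc z z′ y = solve 8
        (λ c o z d e z′ s y → c ⊕ o ⊕ z ⊕ (o ⊕ d) ⊕ e ⊕ z′ ⊕ s ⊕ y ⊜
                              (c ⊕ o ⊕ z ⊕ (o ⊕ d) ⊕ e ⊕ z′ ⊕ s) ⊕ y)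
        refl c (𝟏 ∷ []) z d (𝟎 ∷ []) z′ s y

    -- x ends the word
    final : b ≡ [] → d ≡ [] ⊎ (∃₂ λ s k → d ≡ s ++ 𝟏 ∷ 𝟎^ (suc k)) → Edge (u ♯ʷ v) (u′ ♯ʷ v)
    final refl (inj₁ refl) = subst₂ Edge
      (value (c ++ 𝟏 ∷ 𝟎^ N) 0 (sym (++-assoc c (𝟏 ∷ 𝟎^ N) _)) pu
        (sym (++-assoc c (𝟏 ∷ 𝟎^ N) _)))
      (value (c ++ 𝟏 ∷ 𝟎^ j) (suc i)
        (trans (cong (λ z → c ++ 𝟏 ∷ 𝟎^ j ++ 𝟏 ∷ 𝟎 ∷ 𝟎 ∷ z) (++-identityʳ (𝟎^ i)))
               (sym (++-assoc c (𝟏 ∷ 𝟎^ j) _)))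
        pu′ (sym (++-assoc c (𝟏 ∷ 𝟎^ j) _)))
      (edge c j i q r pq (followedP pr))
    final refl (inj₂ (s , k , refl)) = subst₂ Edge
      (value (c ++ 𝟏 ∷ 𝟎^ N ++ 𝟏 ∷ s) (suc k)
        (trans (cong (λ z → c ++ 𝟏 ∷ 𝟎^ N ++ 𝟏 ∷ z)
                 (trans (++-assoc s (𝟏 ∷ 𝟎^ (suc k)) _) (cong (λ z → s ++ 𝟏 ∷ z) (zeros∷ʳ []))))
          (trans (assoc (𝟎^ N) (𝟏 ∷ 𝟎 ∷ 𝟎^ (suc k) ++ [])) (cong (λ z → (c ++ 𝟏 ∷ 𝟎^ N ++ 𝟏 ∷ s) ++ 𝟏 ∷ z) (++-identityʳ (𝟎^ (suc (suc k)))))))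
        pu
        (trans (cong (λ z → c ++ 𝟏 ∷ 𝟎^ N ++ 𝟏 ∷ z) (tail r))
               (assoc (𝟎^ N) _)))
      (value (c ++ 𝟏 ∷ 𝟎^ j ++ 𝟏 ∷ s) (suc k + suc i)
        (trans (cong (λ z → c ++ 𝟏 ∷ 𝟎^ j ++ 𝟏 ∷ z)
                 (trans (++-assoc s (𝟏 ∷ 𝟎^ (suc k)) _) (cong (λ z → s ++ 𝟏 ∷ z) (zeros∷ʳ (𝟎^ (suc i) ++ [])))))
          (trans (assoc (𝟎^ j) _) (cong (λ z → (c ++ 𝟏 ∷ 𝟎^ j ++ 𝟏 ∷ s) ++ 𝟏 ∷ 𝟎 ∷ z)
            (trans (sym (zeros-++ (suc k) (suc i) [])) (++-identityʳ (𝟎^ (suc k + suc i)))))))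
        pu′
        (trans (cong (λ z → c ++ 𝟏 ∷ 𝟎^ j ++ 𝟏 ∷ z) (tail (𝟎^ (suc i) ++ r)))
          (trans (assoc (𝟎^ j) _) (cong (λ z → (c ++ 𝟏 ∷ 𝟎^ j ++ 𝟏 ∷ s) ++ 𝟏 ∷ q ++ 𝟎 ∷ z)
            (sym (zeros-++ (suc k) (suc i) r))))))
      (edge c j i (s ++ 𝟏 ∷ q ++ 𝟎^ (suc k)) r (insertP s pq pd) (followedP pr))
      where
      zeros∷ʳ : ∀ y → 𝟎^ (suc k) ++ 𝟎 ∷ y ≡ 𝟎^ (suc (suc k)) ++ y
      zeros∷ʳ = zeros-∷ (suc k)

      tail : ∀ y → (s ++ 𝟏 ∷ q ++ 𝟎^ (suc k)) ++ 𝟎 ∷ y ≡ s ++ 𝟏 ∷ q ++ 𝟎^ (suc (suc k)) ++ y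
      tail y = trans (solve 5 (λ s o q z y → (s ⊕ o ⊕ q ⊕ z) ⊕ y ⊜ s ⊕ o ⊕ q ⊕ z ⊕ y)
                        refl s (𝟏 ∷ []) q (𝟎^ (suc k)) (𝟎 ∷ y))
                     (cong (λ z → s ++ 𝟏 ∷ q ++ z) (zeros∷ʳ y))

      assoc : ∀ z y → c ++ 𝟏 ∷ z ++ 𝟏 ∷ s ++ y ≡ (c ++ 𝟏 ∷ z ++ 𝟏 ∷ s) ++ y
      assoc z y = solve 5 (λ c o z s y → c ⊕ o ⊕ z ⊕ (o ⊕ s) ⊕ y ⊜ (c ⊕ o ⊕ z ⊕ (o ⊕ s)) ⊕ y)
        refl c (𝟏 ∷ []) z s y

    go : Followed b → d ≡ [] ⊎ (∃₂ λ s k → d ≡ s ++ 𝟏 ∷ 𝟎^ (suc k)) →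
         b ≡ 𝟎^ (proj₁ (rest pu)) ⊎ (∃₂ λ s k → b ≡ s ++ 𝟏 ∷ 𝟎^ (suc k)) →
         Edge (u ♯ʷ v) (u′ ♯ʷ v)
    go (inj₁ e) dp _ = final e dp
    go fb@(inj₂ _) _ (inj₂ (s , k , e)) = after s k e fb
    go (inj₂ (b′ , e)) _ (inj₁ e′) with proj₁ (rest pu) | trans (sym e) e′
    ... | zero  | ()
    ... | suc _ | ()

module _ (s : Word) (k : ℕ) (pu : Path 0 (s ++ 𝟏 ∷ 𝟎^ (suc k)) 0) where

  open MonoidSolver (++-monoid Letter)

  private
    u = s ++ 𝟏 ∷ 𝟎^ (suc k)

    value : ∀ {v t} q r → v ≡ 𝟏 ∷ q ++ 𝟎 ∷ r → Path 0 q 0 → Path 0 r 0 →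
            t ≡ s ++ 𝟏 ∷ q ++ 𝟎^ (suc k) ++ r → t ≡ u ♯ʷ v
    value q r refl pq pr e = trans e (sym (♯ʷ-shape s k q r pu pq pr))

    -- the moved subpath starts no earlier than the first return
    beyond : ∀ c e j i d b → c ∷ʳ 𝟏 ≡ 𝟏 ∷ e → ∀ {h} → Path 0 e h → Path 0 d 0 → Followed b →
             Path (suc h) (𝟎^ (j + suc i) ++ 𝟏 ∷ d ++ 𝟎 ∷ b) 0 →
             Edge (u ♯ʷ (c ++ 𝟏 ∷ 𝟎^ (j + suc i) ++ 𝟏 ∷ d ++ 𝟎 ∷ b))
                  (u ♯ʷ (c ++ 𝟏 ∷ 𝟎^ j ++ 𝟏 ∷ d ++ 𝟎 ∷ 𝟎^ (suc i) ++ b))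
    beyond c e j i d b ce {h} pe pd fol p with zerosP⁻ (j + suc i) p
    ... | zero , eh , p′ with pb ← factorP⁻ pd p′ = subst₂ Edge
      (value (e ++ 𝟎^ (j + i)) (𝟏 ∷ d ++ 𝟎 ∷ b)
        (trans (shift _)
          (trans (cong (λ n → 𝟏 ∷ e ++ 𝟎^ n ++ 𝟏 ∷ d ++ 𝟎 ∷ b) (trans (+-suc j i) (+-comm 1 (j + i))))
            (cong (𝟏 ∷_) (trans (cong (e ++_) (zeros-++ (j + i) 1 _)) (sym (++-assoc e (𝟎^ (j + i)) _))))))
        (pe ⊙ subst (λ n → Path n (𝟎^ (j + i)) 0) (sym hji) (zerosP (j + i)))
        p′
        (trans (++-assoc s c _) (cong (s ++_) (trans (shift _) (cong (𝟏 ∷_)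
          (trans (cong (e ++_)
                   (trans (cong (λ n → 𝟎^ n ++ 𝟏 ∷ d ++ 𝟎 ∷ b) (trans (cong (j +_) (sym (+-suc i k))) (sym (+-assoc j i (suc k)))))
                          (zeros-++ (j + i) (suc k) _)))
                 (sym (++-assoc e (𝟎^ (j + i)) _))))))))
      (value (e ++ 𝟎^ j ++ 𝟏 ∷ d ++ 𝟎 ∷ 𝟎^ i) b
        (trans (shift _) (cong (𝟏 ∷_)
          (trans (cong (λ z → e ++ 𝟎^ j ++ 𝟏 ∷ d ++ 𝟎 ∷ z) (sym (zeros-∷ i b)))
                 (assoc (𝟎^ j) (𝟎^ i) (𝟎 ∷ b)))))
        (pe ⊙ subst (λ n → Path n _ 0) (sym (trans hji (+-assoc j i 0)))
          (zerosP j ⊙ factorP⊙ pd (zerosP i)))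
        pb
        (trans (++-assoc s c _) (cong (s ++_) (trans (shift _) (cong (𝟏 ∷_)
          (trans (cong (λ z → e ++ 𝟎^ j ++ 𝟏 ∷ d ++ 𝟎 ∷ z)
                   (trans (cong (λ n → 𝟎^ n ++ b) (sym (+-suc i k))) (zeros-++ i (suc k) b)))
                 (assoc (𝟎^ j) (𝟎^ i) (𝟎^ (suc k) ++ b))))))))
      (edge (s ++ c) j (i + k) d b pd fol)
      where
      hji : h ≡ (j + i) + 0
      hji = suc-injective (trans eh (cong (_+ 0) (+-suc j i)))

      shift : ∀ y → c ++ 𝟏 ∷ y ≡ 𝟏 ∷ e ++ y
      shift y = trans (sym (++-assoc c (𝟏 ∷ []) y)) (cong (_++ y) ce)

      assoc : ∀ z z′ y → e ++ z ++ 𝟏 ∷ d ++ 𝟎 ∷ z′ ++ y ≡ (e ++ z ++ 𝟏 ∷ d ++ 𝟎 ∷ z′) ++ y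
      assoc z z′ y = solve 7 (λ e z o d f z′ y → e ⊕ z ⊕ (o ⊕ d) ⊕ f ⊕ z′ ⊕ y ⊜ (e ⊕ z ⊕ (o ⊕ d) ⊕ f ⊕ z′) ⊕ y)
        refl e z (𝟏 ∷ []) d (𝟎 ∷ []) z′ y
    ... | suc h′ , eh , p′ with firstReturn (factorP⁻ pd p′)
    ...   | b₁ , r , refl , pb , pr = subst₂ Edge
      (value (e ++ 𝟎^ (j + suc i) ++ 𝟏 ∷ d ++ 𝟎 ∷ b₁) r
        (trans (shift _) (cong (𝟏 ∷_) (assoc (𝟎^ (j + suc i)) [] (𝟎 ∷ r))))
        (pe ⊙ subst (λ n → Path n _ 0) (sym hh) (zerosP (j + suc i) ⊙ factorP⊙ pd pb))
        pr
        (trans (++-assoc s c _) (cong (s ++_) (trans (shift _)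
          (cong (𝟏 ∷_) (assoc (𝟎^ (j + suc i)) [] (𝟎^ (suc k) ++ r)))))))
      (value (e ++ 𝟎^ j ++ 𝟏 ∷ d ++ 𝟎 ∷ 𝟎^ (suc i) ++ b₁) r
        (trans (shift _) (cong (𝟏 ∷_) (assoc (𝟎^ j) (𝟎^ (suc i)) (𝟎 ∷ r))))
        (pe ⊙ subst (λ n → Path n _ 0) (sym (trans hh (+-assoc j (suc i) h′)))
          (zerosP j ⊙ factorP⊙ pd (zerosP (suc i) ⊙ pb)))
        pr
        (trans (++-assoc s c _) (cong (s ++_) (trans (shift _)
          (cong (𝟏 ∷_) (assoc (𝟎^ j) (𝟎^ (suc i)) (𝟎^ (suc k) ++ r)))))))
      (edge (s ++ c) j i d (b₁ ++ 𝟎^ (suc k) ++ r) pd (fol′ b₁ fol))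
      where
      hh : h ≡ (j + suc i) + h′
      hh = suc-injective (trans eh (+-suc (j + suc i) h′))

      shift : ∀ y → c ++ 𝟏 ∷ y ≡ 𝟏 ∷ e ++ y
      shift y = trans (sym (++-assoc c (𝟏 ∷ []) y)) (cong (_++ y) ce)

      fol′ : ∀ b₁ {y z} → Followed (b₁ ++ 𝟎 ∷ y) → Followed (b₁ ++ z)
      fol′ [] (inj₁ ())
      fol′ [] (inj₂ (_ , ()))
      fol′ (𝟏 ∷ b₁) _ = inj₂ (_ , refl)
      fol′ (𝟎 ∷ b₁) (inj₁ ())
      fol′ (𝟎 ∷ b₁) (inj₂ (_ , ()))

      assoc : ∀ z z′ y → e ++ z ++ 𝟏 ∷ d ++ 𝟎 ∷ z′ ++ b₁ ++ y ≡
                         (e ++ z ++ 𝟏 ∷ d ++ 𝟎 ∷ z′ ++ b₁) ++ y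
      assoc z z′ y = solve 8
        (λ e z o d f z′ b y → e ⊕ z ⊕ (o ⊕ d) ⊕ f ⊕ z′ ⊕ b ⊕ y ⊜
                              (e ⊕ z ⊕ (o ⊕ d) ⊕ f ⊕ z′ ⊕ b) ⊕ y)
        refl e z (𝟏 ∷ []) d (𝟎 ∷ []) z′ b₁ y

  edge-♯ʷʳ : ∀ {v v′} → Edge v v′ → Path 0 v 0 → Edge (u ♯ʷ v) (u ♯ʷ v′)
  edge-♯ʷʳ (edge [] j i d b pd fol) (up p) = beyond [] [] j i d b refl nil pd fol p
  edge-♯ʷʳ (edge (𝟏 ∷ c) j i d b pd fol) (up p) with splitP c p
  ... | h , pc , up p₁ with lower pc
  ...   | inj₂ (h′ , refl , pc′) =
    beyond (𝟏 ∷ c) (c ∷ʳ 𝟏) j i d b refl (pc′ ⊙ up nil) pd fol p₁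
  ...   | inj₁ (q , r , refl , pq , pr) = subst₂ Edge
    (value q (r ++ 𝟏 ∷ 𝟎^ (j + suc i) ++ 𝟏 ∷ d ++ 𝟎 ∷ b)
      (cong (𝟏 ∷_) (++-assoc q (𝟎 ∷ r) _)) pq pr₁ (assoc _))
    (value q (r ++ 𝟏 ∷ 𝟎^ j ++ 𝟏 ∷ d ++ 𝟎 ∷ 𝟎^ (suc i) ++ b)
      (cong (𝟏 ∷_) (++-assoc q (𝟎 ∷ r) _)) pq (edgeP (edge r j i d b pd fol) pr₁) (assoc _))
    (edge (s ++ 𝟏 ∷ q ++ 𝟎^ (suc k) ++ r) j i d b pd fol)
    where
    pr₁ : Path 0 (r ++ 𝟏 ∷ 𝟎^ (j + suc i) ++ 𝟏 ∷ d ++ 𝟎 ∷ b) 0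
    pr₁ = pr ⊙ up p₁

    assoc : ∀ y → (s ++ 𝟏 ∷ q ++ 𝟎^ (suc k) ++ r) ++ y ≡ s ++ 𝟏 ∷ q ++ 𝟎^ (suc k) ++ r ++ y
    assoc y = solve 6 (λ s o q z r y → (s ⊕ o ⊕ q ⊕ z ⊕ r) ⊕ y ⊜ s ⊕ o ⊕ q ⊕ z ⊕ r ⊕ y)
      refl s (𝟏 ∷ []) q (𝟎^ (suc k)) r y

edge-♯ˡ : ∀ {m n} {u u′ : Dyck (suc m)} (v : Dyck (suc n)) → u ⟶ u′ → u ♯ v ⟶ u′ ♯ v
edge-♯ˡ {u = u} {u′} v e = fromEdge {u = u ♯ v} {u′ ♯ v} (go (word v) (return v))
  where
  go : ∀ w → (∃₂ λ q r → w ≡ 𝟏 ∷ q ++ 𝟎 ∷ r × Path 0 q 0 × Path 0 r 0) →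
       Edge (word u ♯ʷ w) (word u′ ♯ʷ w)
  go _ (q , r , refl , pq , pr) = edge-♯ʷˡ q r pq pr (toEdge {u = u} {u′} e) (toPath u)

edge-♯ʳ : ∀ {m n} (u : Dyck (suc m)) {v v′ : Dyck (suc n)} → v ⟶ v′ → u ♯ v ⟶ u ♯ v′
edge-♯ʳ u {v} {v′} e = fromEdge {u = u ♯ v} {u ♯ v′} (go (word u) (peak u) (toPath u))
  where
  go : ∀ w → (∃₂ λ s k → w ≡ s ++ 𝟏 ∷ 𝟎^ (suc k)) → Path 0 w 0 →
       Edge (w ♯ʷ word v) (w ♯ʷ word v′)
  go _ (s , k , refl) pu = edge-♯ʷʳ s k pu (toEdge {u = v} {v′} e) (toPath v)

♯-mono : ∀ {m n} {u u′ : Dyck (suc m)} {v v′ : Dyck (suc n)} →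
         u ≼ u′ → v ≼ v′ → u ♯ v ≼ u′ ♯ v′
♯-mono {u′ = u′} {v = v} p q =
  gmap (_♯ v) (λ {x y} → edge-♯ˡ {u = x} {y} v) p ◅◅
  gmap (u′ ♯_) (λ {x y} → edge-♯ʳ u′ {x} {y}) q

Peak : Word → Set
Peak u = ∃₂ λ s k → u ≡ s ++ 𝟏 ∷ 𝟎^ (suc k)

Return : Word → Set
Return v = ∃₂ λ q r → v ≡ 𝟏 ∷ q ++ 𝟎 ∷ r × Path 0 q 0 × Path 0 r 0

♯ʷ-assoc′ : ∀ u v w → Peak u → Path 0 u 0 → Return v → Path 0 v 0 → Return w →
            Path 0 (u ♯ʷ v) 0 → (u ♯ʷ v) ♯ʷ w ≡ u ♯ʷ (v ♯ʷ w)
♯ʷ-assoc′ u v w (s , k , refl) pu (q , r , refl , pq , pr) pv (x , y , refl , px , py) puv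
  with lastPeak pr
... | inj₂ (r′ , l , refl) = trans
  (value (u ♯ʷ v) (s ++ 𝟏 ∷ q ++ 𝟎^ (suc k) ++ r′) l
    (trans (♯ʷ-shape s k q r pu pq pr) (assoc₁ (𝟏 ∷ 𝟎^ (suc l)))) puv x y px py)
  (trans (sym (assoc₁ (𝟏 ∷ x ++ 𝟎^ (suc l) ++ y)))
    (trans (sym (♯ʷ-shape s k q (r′ ++ 𝟏 ∷ x ++ 𝟎^ (suc l) ++ y) pu pq (shapeP r′ l x y pr px py)))
      (cong (u ♯ʷ_) (sym (trans
        (value v (𝟏 ∷ q ++ 𝟎 ∷ r′) l (assoc₂ (𝟏 ∷ 𝟎^ (suc l))) pv x y px py)
        (sym (assoc₂ (𝟏 ∷ x ++ 𝟎^ (suc l) ++ y))))))))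
  where
  open MonoidSolver (++-monoid Letter)

  value : ∀ t s l → t ≡ s ++ 𝟏 ∷ 𝟎^ (suc l) → Path 0 t 0 → ∀ x y → Path 0 x 0 → Path 0 y 0 →
          t ♯ʷ (𝟏 ∷ x ++ 𝟎 ∷ y) ≡ s ++ 𝟏 ∷ x ++ 𝟎^ (suc l) ++ y
  value _ s l refl p x y px py = ♯ʷ-shape s l x y p px py

  assoc₁ : ∀ z → s ++ 𝟏 ∷ q ++ 𝟎^ (suc k) ++ r′ ++ z ≡ (s ++ 𝟏 ∷ q ++ 𝟎^ (suc k) ++ r′) ++ z
  assoc₁ z = solve 6 (λ s o q k r z → s ⊕ o ⊕ q ⊕ k ⊕ r ⊕ z ⊜ (s ⊕ o ⊕ q ⊕ k ⊕ r) ⊕ z)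
    refl s (𝟏 ∷ []) q (𝟎^ (suc k)) r′ z

  assoc₂ : ∀ z → 𝟏 ∷ q ++ 𝟎 ∷ r′ ++ z ≡ (𝟏 ∷ q ++ 𝟎 ∷ r′) ++ z
  assoc₂ z = cong (𝟏 ∷_) (sym (++-assoc q (𝟎 ∷ r′) z))
... | inj₁ refl with lastPeak pq
...   | inj₁ refl = cong₂ _♯ʷ_
  (trans (♯ʷ-shape s k [] [] pu nil nil) (cong (λ z → s ++ 𝟏 ∷ z) (++-identityʳ (𝟎^ (suc k)))))
  (sym (♯ʷ-shape [] 0 x y pv px py))
...   | inj₂ (q′ , l , refl) = trans
  (value (u ♯ʷ v) (s ++ 𝟏 ∷ q′) (l + suc k)
    (trans (♯ʷ-shape s k q [] pu pq nil) (trans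
      (assoc₁ (𝟏 ∷ 𝟎^ (suc l)) (𝟎^ (suc k) ++ []))
      (cong (λ z → (s ++ 𝟏 ∷ q′) ++ 𝟏 ∷ z)
        (trans (sym (zeros-++ (suc l) (suc k) [])) (++-identityʳ (𝟎^ (suc l + suc k)))))))
    puv x y px py)
  (trans (cong (λ z → (s ++ 𝟏 ∷ q′) ++ 𝟏 ∷ x ++ z) (zeros-++ (suc l) (suc k) y))
    (trans (assoc₃ (𝟎^ (suc l)) (𝟎^ (suc k) ++ y))
      (trans (sym (♯ʷ-shape s k (q′ ++ 𝟏 ∷ x ++ 𝟎^ (suc l)) y pu (insertP q′ px pq) py))
        (cong (u ♯ʷ_) (sym (trans
          (value v (𝟏 ∷ q′) (suc l) (cong (𝟏 ∷_)
            (trans (++-assoc q′ (𝟏 ∷ 𝟎^ (suc l)) _)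
              (cong (λ z → q′ ++ 𝟏 ∷ z) (trans (zeros-∷ (suc l) []) (++-identityʳ (𝟎^ (suc (suc l))))))))
            pv x y px py)
          (cong (𝟏 ∷_) (trans (cong (λ z → q′ ++ 𝟏 ∷ x ++ z) (sym (zeros-∷ (suc l) y)))
            (assoc₄ (𝟎^ (suc l)) (𝟎 ∷ y))))))))))
  where
  open MonoidSolver (++-monoid Letter)

  value : ∀ t s l → t ≡ s ++ 𝟏 ∷ 𝟎^ (suc l) → Path 0 t 0 → ∀ x y → Path 0 x 0 → Path 0 y 0 →
          t ♯ʷ (𝟏 ∷ x ++ 𝟎 ∷ y) ≡ s ++ 𝟏 ∷ x ++ 𝟎^ (suc l) ++ y
  value _ s l refl p x y px py = ♯ʷ-shape s l x y p px py

  assoc₁ : ∀ z z′ → s ++ 𝟏 ∷ (q′ ++ z) ++ z′ ≡ (s ++ 𝟏 ∷ q′) ++ z ++ z′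
  assoc₁ z z′ = solve 5 (λ s o q z z′ → s ⊕ o ⊕ (q ⊕ z) ⊕ z′ ⊜ (s ⊕ o ⊕ q) ⊕ z ⊕ z′)
    refl s (𝟏 ∷ []) q′ z z′

  assoc₃ : ∀ z z′ → (s ++ 𝟏 ∷ q′) ++ 𝟏 ∷ x ++ z ++ z′ ≡ s ++ 𝟏 ∷ (q′ ++ 𝟏 ∷ x ++ z) ++ z′
  assoc₃ z z′ = solve 6 (λ s o q x z z′ → (s ⊕ o ⊕ q) ⊕ (o ⊕ x) ⊕ z ⊕ z′ ⊜ s ⊕ o ⊕ (q ⊕ (o ⊕ x) ⊕ z) ⊕ z′)
    refl s (𝟏 ∷ []) q′ x z z′

  assoc₄ : ∀ z z′ → q′ ++ 𝟏 ∷ x ++ z ++ z′ ≡ (q′ ++ 𝟏 ∷ x ++ z) ++ z′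
  assoc₄ z z′ = solve 5 (λ q o x z z′ → q ⊕ (o ⊕ x) ⊕ z ⊕ z′ ⊜ (q ⊕ (o ⊕ x) ⊕ z) ⊕ z′)
    refl q′ (𝟏 ∷ []) x z z′

♯ʷ-assoc : ∀ {l m n} (u : Dyck (suc l)) (v : Dyck (suc m)) (w : Dyck (suc n)) →
           (word u ♯ʷ word v) ♯ʷ word w ≡ word u ♯ʷ (word v ♯ʷ word w)
♯ʷ-assoc u v w = ♯ʷ-assoc′ (word u) (word v) (word w)
  (peak u) (toPath u) (return v) (toPath v) (return w) (♯ʷ-path u v)

♯ʷ-identityˡ : ∀ {n} (v : Dyck (suc n)) → (𝟏 ∷ 𝟎 ∷ []) ♯ʷ word v ≡ word v
♯ʷ-identityˡ v = go (word v) (return v)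
  where
  go : ∀ w → Return w → (𝟏 ∷ 𝟎 ∷ []) ♯ʷ w ≡ w
  go _ (q , r , refl , pq , pr) = ♯ʷ-shape [] 0 q r (up (down nil)) pq pr

♯ʷ-identityʳ : ∀ {n} (u : Dyck (suc n)) → word u ♯ʷ (𝟏 ∷ 𝟎 ∷ []) ≡ word u
♯ʷ-identityʳ u = go (word u) (peak u) (toPath u)
  where
  go : ∀ w → Peak w → Path 0 w 0 → w ♯ʷ (𝟏 ∷ 𝟎 ∷ []) ≡ w
  go _ (s , k , refl) pu = trans (♯ʷ-shape s k [] [] pu nil nil)
    (cong (λ z → s ++ 𝟏 ∷ z) (++-identityʳ (𝟎^ (suc k))))

record Interval : Set where
  constructor ⟨_,_,_⟩
  field
    {pred-size} : ℕ
    bottom top  : Dyck (suc pred-size)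
    bottom≼top  : bottom ≼ top

open Interval public using (bottom; top; bottom≼top)

infix 4 _≈_

-- Intervals are compared by their end points, which as words also determine
-- the size; the witness of bottom ≼ top is ignored.
_≈_ : Interval → Interval → Set
I ≈ J = word (bottom I) ≡ word (bottom J) × word (top I) ≡ word (top J)

infixl 7 _∙_

_∙_ : Interval → Interval → Interval
I ∙ J = ⟨ bottom I ♯ bottom J , top I ♯ top J , ♯-mono (bottom≼top I) (bottom≼top J) ⟩

⟨10⟩ : Dyck 1
⟨10⟩ = dyck (𝟏 ∷ 𝟎 ∷ []) refl refl (z≤n ∷ z≤n ∷ s≤s z≤n ∷ [])

unit : Interval
unit = ⟨ ⟨10⟩ , ⟨10⟩ , ε ⟩

𝕄₂ : Monoid _ _
𝕄₂ = record
  { Carrier  = Interval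
  ; _≈_      = _≈_
  ; _∙_      = _∙_
  ; ε        = unit
  ; isMonoid = record
    { isSemigroup = record
      { isMagma = record
        { isEquivalence = record
          { refl  = refl , refl
          ; sym   = λ (p , q) → sym p , sym q
          ; trans = λ (p , q) (p′ , q′) → trans p p′ , trans q q′
          }
        ; ∙-cong = λ (p , q) (p′ , q′) → cong₂ _♯ʷ_ p p′ , cong₂ _♯ʷ_ q q′
        }
      ; assoc = λ I J K → ♯ʷ-assoc (bottom I) (bottom J) (bottom K) , ♯ʷ-assoc (top I) (top J) (top K)
      }
    ; identity = (λ I → ♯ʷ-identityˡ (bottom I) , ♯ʷ-identityˡ (top I))
               , (λ I → ♯ʷ-identityʳ (bottom I) , ♯ʷ-identityʳ (top I))
    }
  }

-- M is free on the elements satisfying G when evaluation is an isomorphism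
-- from the monoid of words over these elements onto M.
module _ {c ℓ p : Level} (M : Monoid c ℓ) (G : Pred (Monoid.Carrier M) p) where

  private module M = Monoid M

  wordMonoid : RawMonoid (c ⊔ p) (c ⊔ ℓ ⊔ p)
  wordMonoid = record
    { Carrier = List (∃ G)
    ; _≈_     = Pointwise (λ g h → proj₁ g M.≈ proj₁ h)
    ; _∙_     = _++_
    ; ε       = []
    }

  evaluate : List (∃ G) → M.Carrier
  evaluate = foldr (λ g x → proj₁ g M.∙ x) M.ε

  IsFreeOn : Set (c ⊔ ℓ ⊔ p)
  IsFreeOn = MonoidMorphisms.IsMonoidIsomorphism wordMonoid M.rawMonoid evaluate

⟨1010⟩ : Dyck 2
⟨1010⟩ = dyck (𝟏 ∷ 𝟎 ∷ 𝟏 ∷ 𝟎 ∷ []) refl refl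
  (z≤n ∷ z≤n ∷ s≤s z≤n ∷ s≤s z≤n ∷ s≤s (s≤s z≤n) ∷ [])

Generator : Pred Interval _
Generator I =
  (∃₂ λ n (w : Dyck n) → word (top I) ≡ 𝟏 ∷ word w ++ 𝟏 ∷ 𝟎 ∷ 𝟎 ∷ []) ⊎
  I ≈ ⟨ ⟨1010⟩ , ⟨1010⟩ , ε ⟩

{-# OPTIONS --safe #-}
-- Let s 1 0ᵏ⁺¹ be the factorization of u at its last peak.  Then
--   u ♯ (1 0 1 0) = u 1 0  and  u ♯ (1 w 1 0 0) = s 1 w 1 0ᵏ⁺²,
-- so every Dyck path other than 1 0 is u ♯ g with g irreducible, i.e. of one of
-- these two forms.  Comparing the moved subpath with the last peak shows that an
-- edge into u ♯ g starts at u′ ♯ g with u′ ⟶ u or at u ♯ g′ with g′ ⟶ g.  By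
-- associativity the same holds for u ♯ v with v arbitrary, so the bottom of an
-- interval splits along any factorization of its top; as 1 0 1 0 is minimal,
-- the factors above irreducible tops are generators.  Conversely the top
-- determines its first irreducible factor, and u ♯ v together with the size of
-- u determines u and v, so the first generator can be cancelled.
module Submission where

open import Defs
open import Algebra.Bundles using (Monoid)
import Algebra.Solver.Monoid as MonoidSolver
open import Data.List.Base using (List; []; _∷_; _++_; _∷ʳ_)
open import Data.List.Properties
  using (++-assoc; ++-identityʳ; ++-monoid; ++-cancelˡ; ∷-injectiveˡ; ∷-injectiveʳ; ∷ʳ-injectiveˡ)
open import Data.List.Relation.Binary.Pointwise using (Pointwise; []; _∷_)
import Data.List.Relation.Unary.All as All
open import Data.Nat.Base using (ℕ; zero; suc; _+_; _<_; _≤_; s≤s; z≤n)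
open import Data.Nat.Induction using (Acc; acc; <-wellFounded)
open import Data.Nat.Properties
  using (+-suc; +-comm; +-assoc; +-identityʳ; +-monoʳ-≤; suc-injective; ≤-irrelevant; ≡-irrelevant)
open import Data.Product.Base using (∃; ∃₂; _×_; _,_; proj₁; proj₂)
open import Data.Sum.Base using (_⊎_; inj₁; inj₂)
open import Relation.Binary.Construct.Closure.ReflexiveTransitive using (ε; _◅_)
open import Relation.Binary.PropositionalEquality
import Relation.Binary.Reasoning.Setoid as SetoidReasoning
open import Relation.Nullary.Negation using (¬_; contradiction)

open MonoidSolver (++-monoid Letter) using (solve; _⊕_; _⊜_)

-- Unique decompositions of words and paths.

++-split : ∀ {A : Set} (u s : List A) {v t} → u ++ v ≡ s ++ t →
           (∃ λ e → s ≡ u ++ e × v ≡ e ++ t) ⊎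
           (∃₂ λ l e → u ≡ s ++ l ∷ e × t ≡ l ∷ e ++ v)
++-split []      s       eq   = inj₁ (s , refl , eq)
++-split (l ∷ u) []      refl = inj₂ (l , u , refl , refl)
++-split (l ∷ u) (m ∷ s) eq with refl ← ∷-injectiveˡ eq | ++-split u s (∷-injectiveʳ eq)
... | inj₁ (e , refl , eq′)     = inj₁ (e , refl , eq′)
... | inj₂ (n , e , refl , eq′) = inj₂ (n , e , refl , eq′)

-- The function `splitTrailing` recovers `s 1` and `k` from the word.
lastPeak-unique : ∀ s s′ {k k′} → s ++ 𝟏 ∷ 𝟎^ k ≡ s′ ++ 𝟏 ∷ 𝟎^ k′ → s ≡ s′ × k ≡ k′
lastPeak-unique s s′ {k} {k′} eq = ∷ʳ-injectiveˡ s s′ (cong proj₁ split) , cong proj₂ split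
  where
  split : (s ∷ʳ 𝟏 , k) ≡ (s′ ∷ʳ 𝟏 , k′)
  split = trans (sym (splitTrailing-peak s k)) (trans (cong splitTrailing eq) (splitTrailing-peak s′ k′))

-- A path `w` from 0 to 0, when started at `suc h`, ends at `suc h` rather than at 0.
¬climbing-suffix : ∀ s {w} → Path 0 (s ++ 𝟏 ∷ w) 0 → ¬ Path 0 w 0
¬climbing-suffix s p q with splitP s p
... | h , _ , up p₁ with () ← det (lift (suc h) q) p₁

-- With two different cuts, one remainder would follow a letter 1 inside the other, which
-- `¬climbing-suffix` excludes.
climb-unique : ∀ s s′ {w w′} → s ++ 𝟏 ∷ w ≡ s′ ++ 𝟏 ∷ w′ →
               Path 0 w 0 → Path 0 w′ 0 → s ≡ s′ × w ≡ w′
climb-unique []      []       refl p p′ = refl , refl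
climb-unique []      (_ ∷ s′) refl p p′ = contradiction p′ (¬climbing-suffix s′ p)
climb-unique (_ ∷ s) []       refl p p′ = contradiction p (¬climbing-suffix s p′)
climb-unique (l ∷ s) (m ∷ s′) eq   p p′ with refl ← ∷-injectiveˡ eq | climb-unique s s′ (∷-injectiveʳ eq) p p′
... | refl , refl = refl , refl

-- In a walk started at `h`, the 0 after `q` is the first step below height 0.
firstReturn-unique : ∀ {h q q′ r r′} → Path h q 0 → Path h q′ 0 →
                     q ++ 𝟎 ∷ r ≡ q′ ++ 𝟎 ∷ r′ → q ≡ q′ × r ≡ r′
firstReturn-unique nil      nil       refl = refl , refl
firstReturn-unique nil      (up p′)   ()
firstReturn-unique (up p)   nil       ()
firstReturn-unique (up p)   (up p′)   eq with firstReturn-unique p p′ (∷-injectiveʳ eq)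
... | refl , refl = refl , refl
firstReturn-unique (down p) (down p′) eq with firstReturn-unique p p′ (∷-injectiveʳ eq)
... | refl , refl = refl , refl

#𝟏-prefix-unique : ∀ s s′ {x x′} → s ++ 𝟏 ∷ x ≡ s′ ++ 𝟏 ∷ x′ → #𝟏 s ≡ #𝟏 s′ → s ≡ s′ × x ≡ x′
#𝟏-prefix-unique []      []       refl e = refl , refl
#𝟏-prefix-unique []      (𝟏 ∷ s′) eq   ()
#𝟏-prefix-unique []      (𝟎 ∷ s′) ()   e
#𝟏-prefix-unique (𝟏 ∷ s) []       eq   ()
#𝟏-prefix-unique (𝟎 ∷ s) []       ()   e
#𝟏-prefix-unique (𝟏 ∷ s) (𝟏 ∷ s′) eq   e with #𝟏-prefix-unique s s′ (∷-injectiveʳ eq) (suc-injective e)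
... | refl , refl = refl , refl
#𝟏-prefix-unique (𝟎 ∷ s) (𝟎 ∷ s′) eq   e with #𝟏-prefix-unique s s′ (∷-injectiveʳ eq) e
... | refl , refl = refl , refl
#𝟏-prefix-unique (𝟏 ∷ s) (𝟎 ∷ s′) ()   e
#𝟏-prefix-unique (𝟎 ∷ s) (𝟏 ∷ s′) ()   e

-- The last up-step from `k` to `k + 1` is sought, after which the path stays at or above `k + 1`.
-- If there is none, the path never drops below `k + 1` and can be lowered by that amount; this
-- alternative carries the induction and is impossible for a start at 0.
lastClimb′ : ∀ {h p k} → Path h p (suc k) →
             (∃₂ λ s w → p ≡ s ++ 𝟏 ∷ w × Path h s k × Path 0 w 0) ⊎
             (∃ λ h′ → h ≡ suc (h′ + k) × Path h′ p 0)
lastClimb′ nil = inj₂ (0 , refl , nil)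
lastClimb′ (up p) with lastClimb′ p
... | inj₁ (s , w , refl , a , b) = inj₁ (𝟏 ∷ s , w , refl , up a , b)
-- Here `h = k` and the rest stays at or above `k + 1`, so this up-step is the one sought.
... | inj₂ (zero   , refl , a)    = inj₁ ([] , _ , refl , nil , a)
... | inj₂ (suc h′ , refl , a)    = inj₂ (h′ , refl , up a)
lastClimb′ (down p) with lastClimb′ p
... | inj₁ (s , w , refl , a , b) = inj₁ (𝟎 ∷ s , w , refl , down a , b)
... | inj₂ (h′ , refl , a)        = inj₂ (suc h′ , refl , down a)

lastClimb : ∀ {p k} → Path 0 p (suc k) →
            ∃₂ λ s w → p ≡ s ++ 𝟏 ∷ w × Path 0 s k × Path 0 w 0
lastClimb p with lastClimb′ p
... | inj₁ x            = x
... | inj₂ (h′ , () , _)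

-- Paths through a peak, and edges read backwards.

zeros⁻ : ∀ n {h} → Path h (𝟎^ n) 0 → h ≡ n
zeros⁻ zero    nil      = refl
zeros⁻ (suc n) (down p) = cong suc (zeros⁻ n p)

peakP⁻ : ∀ s k → Path 0 (s ++ 𝟏 ∷ 𝟎^ (suc k)) 0 → Path 0 s k
peakP⁻ s k p with splitP s p
... | h , a , up (down b) with refl ← zeros⁻ k b = a

peakP : ∀ {s k} → Path 0 s k → Path 0 (s ++ 𝟏 ∷ 𝟎^ (suc k)) 0
peakP {k = k} p = p ⊙ up (down (subst (λ h → Path h (𝟎^ k) 0) (+-identityʳ k) (zerosP k)))

-- When an edge into a product is split, the source in the factor is at first only a word; this
-- makes it a Dyck path.
edgeP⁻ : ∀ {w w′} → Edge w w′ → Path 0 w′ 0 → Path 0 w 0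
edgeP⁻ (edge c j i d b pd _) p with splitP c p
... | h , pc , up p₁ with zerosP⁻ j p₁
... | h₂ , e , p₂ with zerosP⁻ (suc i) (factorP⁻ pd p₂)
... | h₃ , refl , p₃ = pc ⊙ up (subst (λ z → Path z (𝟎^ (j + suc i) ++ 𝟏 ∷ d ++ 𝟎 ∷ b) 0)
        (sym (trans e (sym (+-assoc j (suc i) h₃))))
        (zerosP (j + suc i) ⊙ factorP⊙ pd p₃))

edge-#𝟏 : ∀ {w w′} → Edge w w′ → #𝟏 w ≡ #𝟏 w′
edge-#𝟏 (edge c j i d b _ _) = begin
  #𝟏 (c ++ 𝟏 ∷ 𝟎^ (j + suc i) ++ 𝟏 ∷ d ++ 𝟎 ∷ b)
    ≡⟨ count (𝟎^ (j + suc i)) [] (#𝟏-zeros (j + suc i)) refl ⟩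
  #𝟏 c + suc (suc (#𝟏 d + #𝟏 b))
    ≡⟨ count (𝟎^ j) (𝟎^ suc i) (#𝟏-zeros j) (#𝟏-zeros i) ⟨
  #𝟏 (c ++ 𝟏 ∷ 𝟎^ j ++ 𝟏 ∷ d ++ 𝟎 ∷ 𝟎^ (suc i) ++ b) ∎
  where
  open ≡-Reasoning
  count : ∀ y z → #𝟏 y ≡ 0 → #𝟏 z ≡ 0 →
          #𝟏 (c ++ 𝟏 ∷ y ++ 𝟏 ∷ d ++ 𝟎 ∷ z ++ b) ≡ #𝟏 c + suc (suc (#𝟏 d + #𝟏 b))
  count y z ey ez
    rewrite #𝟏-++ c (𝟏 ∷ y ++ 𝟏 ∷ d ++ 𝟎 ∷ z ++ b) | #𝟏-++ y (𝟏 ∷ d ++ 𝟎 ∷ z ++ b)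
          | #𝟏-++ d (𝟎 ∷ z ++ b) | #𝟏-++ z b | ey | ez = refl

-- Products with an irreducible right factor.

peakOf : ∀ {l u} → Path 0 (l ∷ u) 0 → Peak (l ∷ u)
peakOf p with lastPeak p
... | inj₁ ()
... | inj₂ x = x

♯ʷ-1010 : ∀ {l u} → Path 0 (l ∷ u) 0 → (l ∷ u) ♯ʷ word ⟨1010⟩ ≡ l ∷ u ++ 𝟏 ∷ 𝟎 ∷ []
♯ʷ-1010 {l} {u} p = go (peakOf p) p
  where
  go : ∀ {u} → Peak u → Path 0 u 0 → u ♯ʷ word ⟨1010⟩ ≡ u ++ 𝟏 ∷ 𝟎 ∷ []
  go (s , k , refl) p = trans (♯ʷ-shape s k [] (𝟏 ∷ 𝟎 ∷ []) p nil (up (down nil)))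
                              (sym (++-assoc s (𝟏 ∷ 𝟎^ (suc k)) _))

arch : Word → Word
arch w = 𝟏 ∷ w ++ 𝟏 ∷ 𝟎 ∷ 𝟎 ∷ []

archP : ∀ {w} → Path 0 w 0 → Path 0 (arch w) 0
archP p = up (lift 1 p ⊙ up (down (down nil)))

-- The path `arch w` first returns to 0 at its end, so `♯ʷ-shape` applies with `q = w 1 0` and `r`
-- empty.
♯ʷ-arch : ∀ s k {w} → Path 0 (s ++ 𝟏 ∷ 𝟎^ (suc k)) 0 → Path 0 w 0 →
          (s ++ 𝟏 ∷ 𝟎^ (suc k)) ♯ʷ arch w ≡ s ++ 𝟏 ∷ w ++ 𝟏 ∷ 𝟎^ (suc (suc k))
♯ʷ-arch s k {w} p pw = begin
  (s ++ 𝟏 ∷ 𝟎^ (suc k)) ♯ʷ arch w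
    ≡⟨ cong (λ z → (s ++ 𝟏 ∷ 𝟎^ (suc k)) ♯ʷ (𝟏 ∷ z)) (++-assoc w (𝟏 ∷ 𝟎 ∷ []) (𝟎 ∷ [])) ⟨
  (s ++ 𝟏 ∷ 𝟎^ (suc k)) ♯ʷ (𝟏 ∷ (w ++ 𝟏 ∷ 𝟎 ∷ []) ++ 𝟎 ∷ [])   ≡⟨ ♯ʷ-shape s k _ [] p (pw ⊙ up (down nil)) nil ⟩
  s ++ 𝟏 ∷ (w ++ 𝟏 ∷ 𝟎 ∷ []) ++ 𝟎^ (suc k) ++ []               ≡⟨ cong (λ z → s ++ 𝟏 ∷ z) (++-assoc w _ _) ⟩
  s ++ 𝟏 ∷ w ++ 𝟏 ∷ 𝟎^ (suc (suc k)) ++ []                     ≡⟨ cong (λ z → s ++ 𝟏 ∷ w ++ 𝟏 ∷ z) (++-identityʳ _) ⟩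
  s ++ 𝟏 ∷ w ++ 𝟏 ∷ 𝟎^ (suc (suc k))                           ∎
  where open ≡-Reasoning

-- Position of the moved subpath relative to the last peak.

zeros-merge : ∀ m n → 𝟎^ m ++ 𝟎^ n ++ [] ≡ 𝟎^ (m + n)
zeros-merge m n = trans (sym (zeros-++ m n [])) (++-identityʳ (𝟎^ (m + n)))

followed-init : ∀ b {y} → Followed (b ++ 𝟏 ∷ y) → Followed b
followed-init []      _               = inj₁ refl
followed-init (𝟏 ∷ b) _               = inj₂ (b , refl)
followed-init (𝟎 ∷ b) (inj₁ ())
followed-init (𝟎 ∷ b) (inj₂ (_ , ()))

followed-zeros : ∀ n → Followed (𝟎^ n) → n ≡ 0
followed-zeros zero    _               = refl
followed-zeros (suc n) (inj₁ ())
followed-zeros (suc n) (inj₂ (_ , ()))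

-- The sources t of the edges into p 1 0ᵐ: the moved subpath is the last peak,
-- contains it properly, or comes before it.
data PeakSource (t p : Word) : ℕ → Set where
  isPeak   : ∀ c j i → p ≡ c ++ 𝟏 ∷ 𝟎^ j → t ≡ c ++ 𝟏 ∷ 𝟎^ (j + suc i) ++ 𝟏 ∷ 𝟎 ∷ [] →
             PeakSource t p (suc (suc i))
  contains : ∀ c j i d l → Path 0 (d ++ 𝟏 ∷ 𝟎^ (suc l)) 0 → p ≡ c ++ 𝟏 ∷ 𝟎^ j ++ 𝟏 ∷ d →
             t ≡ c ++ 𝟏 ∷ 𝟎^ (j + suc i) ++ 𝟏 ∷ d ++ 𝟏 ∷ 𝟎^ (suc (suc l)) →
             PeakSource t p (suc (suc l) + suc i)
  precedes : ∀ {m} t′ → Edge t′ p → t ≡ t′ ++ 𝟏 ∷ 𝟎^ m → PeakSource t p m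

suffixP : ∀ c z d b → Path 0 (c ++ 𝟏 ∷ z ++ 𝟏 ∷ d ++ 𝟎 ∷ b) 0 → ∃ λ h → Path h b 0
suffixP c z d b p with splitP c p
... | _ , _ , up p₁ with splitP z p₁
... | _ , _ , up p₂ with splitP d p₂
... | _ , _ , down p₃ = _ , p₃

-- The last peak of the target lies in `b` if `b` has a peak, and otherwise in the moved subpath
-- `1 d 0`, which it fills when `d` is empty.
peakSource : ∀ {t t′} p m → Edge t t′ → Path 0 t 0 → t′ ≡ p ++ 𝟏 ∷ 𝟎^ m → PeakSource t p m
peakSource p m (edge c j i d b pd fol) pt eq =
  go fol (lastPeak (proj₂ (suffixP c (𝟎^ (j + suc i)) d b pt))) eq
  where
  go : ∀ {b h} → Followed b → b ≡ 𝟎^ h ⊎ (∃₂ λ s k → b ≡ s ++ 𝟏 ∷ 𝟎^ (suc k)) →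
       c ++ 𝟏 ∷ 𝟎^ j ++ 𝟏 ∷ d ++ 𝟎 ∷ 𝟎^ (suc i) ++ b ≡ p ++ 𝟏 ∷ 𝟎^ m →
       PeakSource (c ++ 𝟏 ∷ 𝟎^ (j + suc i) ++ 𝟏 ∷ d ++ 𝟎 ∷ b) p m
  go fol (inj₂ (b , k , refl)) eq
    with lastPeak-unique (c ++ 𝟏 ∷ 𝟎^ j ++ 𝟏 ∷ d ++ 𝟎 ∷ 𝟎^ (suc i) ++ b) p
           (trans (sym (assoc (𝟎^ j) (𝟎^ (suc i)))) eq)
    where
    assoc : ∀ y z → c ++ 𝟏 ∷ y ++ 𝟏 ∷ d ++ 𝟎 ∷ z ++ b ++ 𝟏 ∷ 𝟎^ (suc k) ≡
                    (c ++ 𝟏 ∷ y ++ 𝟏 ∷ d ++ 𝟎 ∷ z ++ b) ++ 𝟏 ∷ 𝟎^ (suc k)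
    assoc y z = solve 8 (λ c o y d e z b x → c ⊕ o ⊕ y ⊕ (o ⊕ d) ⊕ e ⊕ z ⊕ b ⊕ x ⊜
                                             (c ⊕ o ⊕ y ⊕ (o ⊕ d) ⊕ e ⊕ z ⊕ b) ⊕ x)
      refl c (𝟏 ∷ []) y d (𝟎 ∷ []) z b (𝟏 ∷ 𝟎^ (suc k))
  ... | refl , refl = precedes _ (edge c j i d b pd (followed-init b fol))
    (solve 7 (λ c o y d e b x → c ⊕ o ⊕ y ⊕ (o ⊕ d) ⊕ e ⊕ b ⊕ x ⊜
                                (c ⊕ o ⊕ y ⊕ (o ⊕ d) ⊕ e ⊕ b) ⊕ x)
      refl c (𝟏 ∷ []) (𝟎^ (j + suc i)) d (𝟎 ∷ []) b (𝟏 ∷ 𝟎^ (suc k)))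
  -- A `b` without peak consists of zeros; as no zero may directly follow the subpath in the source,
  -- it is empty.
  go {h = h} fol (inj₁ refl) eq with refl ← followed-zeros h fol | lastPeak pd
  ... | inj₁ refl with lastPeak-unique (c ++ 𝟏 ∷ 𝟎^ j) p
                         (trans (++-assoc c _ _) (trans
                           (cong (λ z → c ++ 𝟏 ∷ 𝟎^ j ++ 𝟏 ∷ 𝟎 ∷ z) (sym (++-identityʳ _))) eq))
  ...   | refl , refl = isPeak c j i refl refl
  go fol (inj₁ refl) eq | inj₂ (d , l , refl)
    with lastPeak-unique (c ++ 𝟏 ∷ 𝟎^ j ++ 𝟏 ∷ d) p (trans (sym regroup) eq)
    where
    regroup : c ++ 𝟏 ∷ 𝟎^ j ++ 𝟏 ∷ (d ++ 𝟏 ∷ 𝟎^ (suc l)) ++ 𝟎 ∷ 𝟎^ (suc i) ++ [] ≡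
              (c ++ 𝟏 ∷ 𝟎^ j ++ 𝟏 ∷ d) ++ 𝟏 ∷ 𝟎^ (suc (suc l) + suc i)
    regroup = trans
      (solve 6 (λ c o y d z x → c ⊕ o ⊕ y ⊕ (o ⊕ (d ⊕ (o ⊕ z))) ⊕ x ⊜ (c ⊕ o ⊕ y ⊕ (o ⊕ d)) ⊕ o ⊕ z ⊕ x)
        refl c (𝟏 ∷ []) (𝟎^ j) d (𝟎^ (suc l)) (𝟎 ∷ 𝟎^ (suc i) ++ []))
      (cong (λ z → (c ++ 𝟏 ∷ 𝟎^ j ++ 𝟏 ∷ d) ++ 𝟏 ∷ z)
        (trans (zeros-∷ (suc l) (𝟎^ (suc i) ++ [])) (zeros-merge (suc (suc l)) (suc i))))
  ...   | refl , refl = contains c j i d l pd refl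
    (cong (λ z → c ++ 𝟏 ∷ 𝟎^ (j + suc i) ++ 𝟏 ∷ z)
      (trans (++-assoc d _ _) (cong (λ z → d ++ 𝟏 ∷ z)
        (trans (zeros-∷ (suc l) []) (++-identityʳ (𝟎^ (suc (suc l))))))))

-- Splitting of edges into a product with an irreducible right factor.

𝟏∉zeros : ∀ j e {z} → 𝟎^ j ≢ e ++ 𝟏 ∷ z
𝟏∉zeros zero    []      ()
𝟏∉zeros zero    (_ ∷ _) ()
𝟏∉zeros (suc j) []      ()
𝟏∉zeros (suc j) (_ ∷ e) eq = 𝟏∉zeros j e (∷-injectiveʳ eq)

regroup : ∀ s c z d z′ b y → s ++ (c ++ 𝟏 ∷ z ++ 𝟏 ∷ d ++ 𝟎 ∷ z′ ++ b) ++ y ≡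
                             (s ++ c) ++ 𝟏 ∷ z ++ 𝟏 ∷ d ++ 𝟎 ∷ z′ ++ b ++ y
regroup s c z d z′ b y = solve 9
  (λ s c o z d e z′ b y → s ⊕ (c ⊕ o ⊕ z ⊕ (o ⊕ d) ⊕ e ⊕ z′ ⊕ b) ⊕ y ⊜
                          (s ⊕ c) ⊕ o ⊕ z ⊕ (o ⊕ d) ⊕ e ⊕ z′ ⊕ b ⊕ y)
  refl s c (𝟏 ∷ []) z d (𝟎 ∷ []) z′ b y

data SplitEdge (t u v : Word) : Set where
  onLeft  : ∀ {u′} → Edge u′ u → t ≡ u′ ♯ʷ v → SplitEdge t u v
  onRight : ∀ {v′} → Edge v′ v → t ≡ u ♯ʷ v′ → SplitEdge t u v

edge-source-♯ʷ-1010 : ∀ {u u′} → Edge u′ u → Path 0 u′ 0 → u′ ♯ʷ word ⟨1010⟩ ≡ u′ ++ 𝟏 ∷ 𝟎 ∷ []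
edge-source-♯ʷ-1010 (edge []      _ _ _ _ _ _) p = ♯ʷ-1010 p
edge-source-♯ʷ-1010 (edge (_ ∷ _) _ _ _ _ _ _) p = ♯ʷ-1010 p

-- One zero follows the last peak of `u 1 0`, while a move of that peak, or of a subpath around it,
-- leaves at least two. So the moved subpath comes before the peak.
splitEdge-1010 : ∀ {t l u} → Path 0 (l ∷ u) 0 → Path 0 t 0 → Edge t ((l ∷ u) ♯ʷ word ⟨1010⟩) →
                 SplitEdge t (l ∷ u) (word ⟨1010⟩)
splitEdge-1010 {l = l} {u} pu pt e with peakSource (l ∷ u) 1 e pt (♯ʷ-1010 pu)
... | precedes t′ e′ refl = onLeft e′ (sym (edge-source-♯ʷ-1010 e′ (edgeP⁻ e′ pu)))

module _ {s k w} (ps : Path 0 (s ++ 𝟏 ∷ 𝟎^ (suc k)) 0) (pw : Path 0 w 0) where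

  private
    u = s ++ 𝟏 ∷ 𝟎^ (suc k)

    -- The peak moves by `k + 1`, over the zeros that `u` contributes after `1 w`; in the right
    -- factor the same move is by 1, from `1 w 0 1 0` to `1 w 1 0 0`.
    peakMoved : ∀ c j → s ++ 𝟏 ∷ w ≡ c ++ 𝟏 ∷ 𝟎^ j →
                SplitEdge (c ++ 𝟏 ∷ 𝟎^ (j + suc k) ++ 𝟏 ∷ 𝟎 ∷ []) u (arch w)
    peakMoved c j eq with ++-split s c eq
    ... | inj₂ (l , e , refl , eq′) = contradiction (∷-injectiveʳ eq′) (𝟏∉zeros j e)
    ... | inj₁ (c , refl , eq′) = onRight {v′ = 𝟏 ∷ w ++ 𝟎 ∷ 𝟏 ∷ 𝟎 ∷ []}
      (subst₂ Edge
        (sym (trans (cong (_++ 𝟎 ∷ 𝟏 ∷ 𝟎 ∷ []) eq′) (trans (++-assoc c _ _)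
          (cong (λ z → c ++ 𝟏 ∷ z) (sym (zeros-++ j 1 _))))))
        (sym (trans (cong (_++ 𝟏 ∷ 𝟎 ∷ 𝟎 ∷ []) eq′) (++-assoc c _ _)))
        (edge c j 0 [] [] nil (inj₁ refl)))
      (sym (begin
        u ♯ʷ (𝟏 ∷ w ++ 𝟎 ∷ 𝟏 ∷ 𝟎 ∷ [])              ≡⟨ ♯ʷ-shape s k w _ ps pw (up (down nil)) ⟩
        s ++ 𝟏 ∷ w ++ 𝟎^ (suc k) ++ 𝟏 ∷ 𝟎 ∷ []       ≡⟨ cong (λ z → s ++ z ++ 𝟎^ (suc k) ++ 𝟏 ∷ 𝟎 ∷ []) eq′ ⟩
        s ++ (c ++ 𝟏 ∷ 𝟎^ j) ++ 𝟎^ (suc k) ++ 𝟏 ∷ 𝟎 ∷ []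
          ≡⟨ solve 6 (λ s c o z z′ x → s ⊕ (c ⊕ o ⊕ z) ⊕ z′ ⊕ x ⊜ (s ⊕ c) ⊕ o ⊕ z ⊕ z′ ⊕ x)
               refl s c (𝟏 ∷ []) (𝟎^ j) (𝟎^ (suc k)) (𝟏 ∷ 𝟎 ∷ []) ⟩
        (s ++ c) ++ 𝟏 ∷ 𝟎^ j ++ 𝟎^ (suc k) ++ 𝟏 ∷ 𝟎 ∷ []
          ≡⟨ cong (λ z → (s ++ c) ++ 𝟏 ∷ z) (zeros-++ j (suc k) _) ⟨
        (s ++ c) ++ 𝟏 ∷ 𝟎^ (j + suc k) ++ 𝟏 ∷ 𝟎 ∷ [] ∎))
      where open ≡-Reasoning

    -- The last climb of 1 d to height l + 1, where the last peak starts, cuts 1 d into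
    -- f 1 w′; then f 1 0ˡ⁺¹ is again a prime path 1 d′ 0.
    cut : ∀ d l → Path 0 (d ++ 𝟏 ∷ 𝟎^ (suc l)) 0 →
          ∃₂ λ f w′ → ∃ λ d′ → 𝟏 ∷ d ≡ f ++ 𝟏 ∷ w′ × Path 0 w′ 0 ×
          Path 0 d′ 0 × f ++ 𝟏 ∷ 𝟎^ (suc l) ≡ 𝟏 ∷ d′ ++ 𝟎 ∷ []
    cut d zero    p = [] , d , [] , refl , peakP⁻ d 0 p , nil , refl
    cut d (suc l) p with lastClimb (peakP⁻ d (suc l) p)
    ... | f , w′ , refl , pf , pw′ = 𝟏 ∷ f , w′ , f ++ 𝟏 ∷ 𝟎^ (suc l) , refl , pw′ , peakP pf ,
      cong (𝟏 ∷_) (trans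
        (cong (λ z → f ++ 𝟏 ∷ z) (sym (trans (zeros-∷ (suc l) []) (++-identityʳ _))))
        (sym (++-assoc f _ _)))

    assoc : ∀ c f z y → c ++ 𝟏 ∷ z ++ f ++ y ≡ (c ++ 𝟏 ∷ z ++ f) ++ y
    assoc c f z y = solve 5 (λ c o z f y → c ⊕ o ⊕ z ⊕ f ⊕ y ⊜ (c ⊕ o ⊕ z ⊕ f) ⊕ y)
      refl c (𝟏 ∷ []) z f y

    -- Both `s 1 w` and the cut of `1 d` end in a climb followed by a path from 0 to 0, so
    -- `climb-unique` gives `s = c 1 0ʲ f` and `w′ = w`. Replacing `1 w 1 0ˡ⁺²` by `1 0ˡ⁺¹` turns
    -- the moved subpath into the prime path `f 1 0ˡ⁺¹`, whose move is an edge into `u`.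
    aroundPeakMoved : ∀ c j i d l → Path 0 (d ++ 𝟏 ∷ 𝟎^ (suc l)) 0 → k ≡ l + suc i →
      s ++ 𝟏 ∷ w ≡ c ++ 𝟏 ∷ 𝟎^ j ++ 𝟏 ∷ d →
      SplitEdge (c ++ 𝟏 ∷ 𝟎^ (j + suc i) ++ 𝟏 ∷ d ++ 𝟏 ∷ 𝟎^ (suc (suc l))) u (arch w)
    aroundPeakMoved c j i d l p refl eq with cut d l p
    ... | f , w′ , d′ , ed , pw′ , pd′ , ef
      with climb-unique s (c ++ 𝟏 ∷ 𝟎^ j ++ f) (trans eq (trans (cong (λ z → c ++ 𝟏 ∷ 𝟎^ j ++ z) ed)
             (assoc c f (𝟎^ j) (𝟏 ∷ w′)))) pw pw′
    ...   | refl , refl = onLeft e (sym (begin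
      u′ ♯ʷ arch w                                                            ≡⟨ ♯ʷ-arch _ l (edgeP⁻ e ps) pw ⟩
      (c ++ 𝟏 ∷ 𝟎^ (j + suc i) ++ f) ++ 𝟏 ∷ w ++ 𝟏 ∷ 𝟎^ (suc (suc l))         ≡⟨ assoc c f (𝟎^ (j + suc i)) _ ⟨
      c ++ 𝟏 ∷ 𝟎^ (j + suc i) ++ f ++ 𝟏 ∷ w ++ 𝟏 ∷ 𝟎^ (suc (suc l))
        ≡⟨ cong (λ z → c ++ 𝟏 ∷ 𝟎^ (j + suc i) ++ z) (++-assoc f (𝟏 ∷ w) _) ⟨
      c ++ 𝟏 ∷ 𝟎^ (j + suc i) ++ (f ++ 𝟏 ∷ w) ++ 𝟏 ∷ 𝟎^ (suc (suc l))
        ≡⟨ cong (λ z → c ++ 𝟏 ∷ 𝟎^ (j + suc i) ++ z ++ 𝟏 ∷ 𝟎^ (suc (suc l))) ed ⟨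
      c ++ 𝟏 ∷ 𝟎^ (j + suc i) ++ 𝟏 ∷ d ++ 𝟏 ∷ 𝟎^ (suc (suc l))                ∎))
      where
      open ≡-Reasoning
      u′ = (c ++ 𝟏 ∷ 𝟎^ (j + suc i) ++ f) ++ 𝟏 ∷ 𝟎^ (suc l)

      e : Edge u′ u
      e = subst₂ Edge
        (trans (cong (λ z → c ++ 𝟏 ∷ 𝟎^ (j + suc i) ++ z) (sym ef)) (assoc c f _ _))
        (trans (cong (λ z → c ++ 𝟏 ∷ 𝟎^ j ++ z) (trans
                 (trans (sym (++-assoc (𝟏 ∷ d′) (𝟎 ∷ []) _)) (cong (_++ 𝟎^ (suc i) ++ []) (sym ef)))
                 (trans (++-assoc f _ _) (cong (λ z → f ++ 𝟏 ∷ z) (zeros-merge (suc l) (suc i))))))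
               (assoc c f _ _))
        (edge c j i d′ [] pd′ (inj₁ refl))

    -- The factor 0ʲ 1 d 0 0ⁱ⁺¹ ends at its lowest height, so after any climb inside it the
    -- path falls below the height reached.
    ¬climb-inside : ∀ j i d e p′ b → Path 0 d 0 → 𝟎^ j ++ 𝟏 ∷ d ++ 𝟎 ∷ 𝟎^ (suc i) ≡ e ++ 𝟏 ∷ p′ →
                    ¬ Path 0 (p′ ++ b) 0
    ¬climb-inside j i d e p′ b pd eq p
      with splitP e (subst (λ z → Path (j + (suc i + 0)) z 0) eq (zerosP j ⊙ factorP⊙ pd (zerosP (suc i))))
    ... | h , _ , up q with splitP p′ p
    ... | h′ , q′ , _ with det q (lift (suc h) q′)
    ... | eh with () ← trans eh (+-suc h′ h)

    -- The position of the 1 after `s` decides: before the 1 preceding the moved factor, the edge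
    -- lies in `w`; in `b`, it lies in `u`. In between, `w` would fall below its start.
    beforePeakMoved : ∀ {t z} → Edge t z → z ≡ s ++ 𝟏 ∷ w →
                      SplitEdge (t ++ 𝟏 ∷ 𝟎^ (suc (suc k))) u (arch w)
    beforePeakMoved (edge c j i d b pd fol) eq with ++-split s c (sym eq)
    -- Here `c = s`, so `w` itself starts with the moved factor and falls below 0.
    ... | inj₁ ([] , refl , eq′) =
      contradiction (subst (λ z → Path 0 z 0) (∷-injectiveʳ eq′) pw) (noFall j)
      where
      noFall : ∀ j → ¬ Path 0 (𝟎^ j ++ 𝟏 ∷ d ++ 𝟎 ∷ 𝟎^ (suc i) ++ b) 0
      noFall zero p with () ← factorP⁻ pd p
    ... | inj₁ (_ ∷ c′ , refl , eq′) with refl ← ∷-injectiveˡ eq′ | refl ← ∷-injectiveʳ eq′ =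
      onRight
      (subst₂ Edge
        (sym (regroup (𝟏 ∷ []) c′ (𝟎^ (j + suc i)) d [] b (𝟏 ∷ 𝟎 ∷ 𝟎 ∷ [])))
        (sym (regroup (𝟏 ∷ []) c′ (𝟎^ j) d (𝟎^ (suc i)) b (𝟏 ∷ 𝟎 ∷ 𝟎 ∷ [])))
        (edge (𝟏 ∷ c′) j i d (b ++ 𝟏 ∷ 𝟎 ∷ 𝟎 ∷ []) pd (followed-++ fol (inj₂ (_ , refl)))))
      (trans
        (solve 8 (λ s c o z d e b y → ((s ⊕ (o ⊕ c)) ⊕ o ⊕ z ⊕ (o ⊕ d) ⊕ e ⊕ b) ⊕ y ⊜
                                      s ⊕ (o ⊕ (c ⊕ o ⊕ z ⊕ (o ⊕ d) ⊕ e ⊕ b)) ⊕ y)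
          refl s c′ (𝟏 ∷ []) (𝟎^ (j + suc i)) d (𝟎 ∷ []) b (𝟏 ∷ 𝟎^ (suc (suc k))))
        (sym (♯ʷ-arch s k ps (edgeP⁻ (edge c′ j i d b pd fol) pw))))
    ... | inj₂ (_ , e , refl , eq′)
      with refl ← ∷-injectiveˡ eq′
         | ++-split (𝟎^ j ++ 𝟏 ∷ d ++ 𝟎 ∷ 𝟎^ (suc i)) e {b} {𝟏 ∷ w} (trans
             (solve 4 (λ y d z b → (y ⊕ d ⊕ z) ⊕ b ⊜ y ⊕ d ⊕ z ⊕ b) refl (𝟎^ j) (𝟏 ∷ d) (𝟎^ (suc (suc i))) b)
             (∷-injectiveʳ eq′))
    ...   | inj₂ (_ , p′ , eq₁ , eq₂) with refl ← ∷-injectiveˡ eq₂ =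
      contradiction (subst (λ z → Path 0 z 0) (∷-injectiveʳ eq₂) pw) (¬climb-inside j i d e p′ b pd eq₁)
    ...   | inj₁ (b′ , refl , refl) = onLeft e′ (trans
      (solve 8 (λ c o z d f b w′ y → (c ⊕ o ⊕ z ⊕ (o ⊕ d) ⊕ f ⊕ b ⊕ o ⊕ w′) ⊕ y ⊜
                                     (c ⊕ o ⊕ z ⊕ (o ⊕ d) ⊕ f ⊕ b) ⊕ (o ⊕ w′) ⊕ y)
        refl c (𝟏 ∷ []) (𝟎^ (j + suc i)) d (𝟎 ∷ []) b′ w (𝟏 ∷ 𝟎^ (suc (suc k))))
      (sym (♯ʷ-arch _ k (edgeP⁻ e′ ps) pw)))
      where
      e′ : Edge ((c ++ 𝟏 ∷ 𝟎^ (j + suc i) ++ 𝟏 ∷ d ++ 𝟎 ∷ b′) ++ 𝟏 ∷ 𝟎^ (suc k))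
                ((c ++ 𝟏 ∷ (𝟎^ j ++ 𝟏 ∷ d ++ 𝟎 ∷ 𝟎^ (suc i)) ++ b′) ++ 𝟏 ∷ 𝟎^ (suc k))
      e′ = subst₂ Edge
        (sym (regroup [] c (𝟎^ (j + suc i)) d [] b′ (𝟏 ∷ 𝟎^ (suc k))))
        (solve 7 (λ c o y d z b x → c ⊕ o ⊕ y ⊕ (o ⊕ d) ⊕ z ⊕ b ⊕ x ⊜
                                    (c ⊕ o ⊕ (y ⊕ (o ⊕ d) ⊕ z) ⊕ b) ⊕ x)
          refl c (𝟏 ∷ []) (𝟎^ j) d (𝟎^ (suc (suc i))) b′ (𝟏 ∷ 𝟎^ (suc k)))
        (edge c j i d (b′ ++ 𝟏 ∷ 𝟎^ (suc k)) pd
          (followed-++ (followed-init b′ fol) (inj₂ (_ , refl))))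

  splitEdge-arch : ∀ {t} → Path 0 t 0 → Edge t (u ♯ʷ arch w) → SplitEdge t u (arch w)
  splitEdge-arch pt e = go refl (peakSource (s ++ 𝟏 ∷ w) (suc (suc k)) e pt
    (trans (♯ʷ-arch s k ps pw) (sym (++-assoc s _ _))))
    where
    go : ∀ {t m} → m ≡ suc (suc k) → PeakSource t (s ++ 𝟏 ∷ w) m → SplitEdge t u (arch w)
    go refl (isPeak c j i eq refl)       = peakMoved c j eq
    go em   (contains c j i d l p eq refl) =
      aroundPeakMoved c j i d l p (suc-injective (suc-injective (sym em))) eq
    go refl (precedes t′ e′ refl)        = beforePeakMoved e′ refl

-- Factorization of Dyck paths into irreducible ones.

word-injective : ∀ {m n} (u : Dyck m) (v : Dyck n) → word u ≡ word v →
                 _≡_ {A = ∃ Dyck} (m , u) (n , v)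
word-injective (dyck w refl e d) (dyck .w refl e′ d′) refl
  rewrite ≡-irrelevant e e′ | All.irrelevant ≤-irrelevant d d′ = refl

data Irreducible (v : Word) : Set where
  isBump : v ≡ word ⟨1010⟩ → Irreducible v
  isArch : ∀ {w} → Path 0 w 0 → v ≡ arch w → Irreducible v

Generator⇒Irreducible : ∀ I → Generator I → Irreducible (word (top I))
Generator⇒Irreducible I (inj₁ (_ , w , e)) = isArch (toPath w) e
Generator⇒Irreducible I (inj₂ (_ , e))     = isBump e

-- Size at least 2 makes the recursion in `factors` descend and keeps the unit from having
-- irreducible factors.
irreducible-pred-size : ∀ {n} (v : Dyck (suc n)) → Irreducible (word v) → 1 ≤ n
irreducible-pred-size v irr = go irr (Dyck.#𝟏-word v)
  where
  arch-#𝟏 : ∀ w {n} → #𝟏 (w ++ 𝟏 ∷ 𝟎 ∷ 𝟎 ∷ []) ≡ n → 1 ≤ n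
  arch-#𝟏 w refl rewrite #𝟏-++ w (𝟏 ∷ 𝟎 ∷ 𝟎 ∷ []) | +-comm (#𝟏 w) 1 = s≤s z≤n

  go : ∀ {v n} → Irreducible v → #𝟏 v ≡ suc n → 1 ≤ n
  go (isBump refl)       refl = s≤s z≤n
  go (isArch {w} _ refl) e    = arch-#𝟏 w (suc-injective e)

peak-#𝟏 : ∀ s k → #𝟏 (s ++ 𝟏 ∷ 𝟎^ k) ≡ suc (#𝟏 s)
peak-#𝟏 s k = begin
  #𝟏 (s ++ 𝟏 ∷ 𝟎^ k)       ≡⟨ #𝟏-++ s _ ⟩
  #𝟏 s + suc (#𝟏 (𝟎^ k))   ≡⟨ cong (λ n → #𝟏 s + suc n) (#𝟏-zeros k) ⟩
  #𝟏 s + 1                 ≡⟨ +-comm (#𝟏 s) 1 ⟩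
  suc (#𝟏 s)               ∎
  where open ≡-Reasoning

data LastFactor (w : Word) : Set where
  trivial : w ≡ word ⟨10⟩ → LastFactor w
  factor  : ∀ {m n} (u : Dyck (suc m)) (v : Dyck (suc n)) → Irreducible (word v) →
            w ≡ word u ♯ʷ word v → LastFactor w

-- If one zero follows the last peak, `1 0 1 0` splits off. Otherwise the last climb to the height
-- where the peak starts marks the beginning of the part `1 w` of an arch.
lastFactor : ∀ s k → Path 0 (s ++ 𝟏 ∷ 𝟎^ (suc k)) 0 → LastFactor (s ++ 𝟏 ∷ 𝟎^ (suc k))
lastFactor s k p = go s k (peakP⁻ s k p)
  where
  go : ∀ s k → Path 0 s k → LastFactor (s ++ 𝟏 ∷ 𝟎^ (suc k))
  go []      zero    p = trivial refl
  go (𝟏 ∷ s) zero    p = factor (fromPath (𝟏 ∷ s) p refl) ⟨1010⟩ (isBump refl) (sym (♯ʷ-1010 p))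
  go s       (suc k) p with lastClimb p
  ... | s , w , refl , ps , pw = factor
    (fromPath _ (peakP ps) (peak-#𝟏 s (suc k)))
    (fromPath (arch w) (archP pw) refl) (isArch pw refl)
    (trans (++-assoc s (𝟏 ∷ w) _) (sym (♯ʷ-arch s k (peakP ps) pw)))

-- Factors are added on the right, because edges are split at the last peak.
data Factors : ∀ {n} → Dyck (suc n) → Set where
  []  : Factors ⟨10⟩
  _▸_ : ∀ {m n} {u : Dyck (suc m)} {v : Dyck (suc n)} →
        Factors u → Irreducible (word v) → Factors (u ♯ v)

factors : ∀ {n} (u : Dyck (suc n)) → Factors u
factors u = go u (<-wellFounded _)
  where
  go : ∀ {n} (u : Dyck (suc n)) → Acc _<_ n → Factors u
  go u (acc rec) with peak u
  ... | s , k , e with lastFactor s k (subst (λ w → Path 0 w 0) e (toPath u))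
  -- Matching on `refl` in `∃ Dyck` identifies the sizes along with the paths.
  ...   | trivial e′ with refl ← word-injective u ⟨10⟩ (trans e e′) = []
  ...   | factor {m} {n} p g irr e′ with refl ← word-injective u (p ♯ g) (trans e e′) =
    -- The recursion descends from `m + n` to `m`, where `n` is at least 1.
    go p (rec (subst (_≤ m + n) (+-comm m 1) (+-monoʳ-≤ m (irreducible-pred-size g irr)))) ▸ irr

-- Chains below products and below `1 0 1 0`.

source : ∀ {n w} (v : Dyck n) → Edge w (word v) → Dyck n
source {w = w} v e = fromPath w (edgeP⁻ e (toPath v)) (trans (edge-#𝟏 e) (Dyck.#𝟏-word v))

source⟶ : ∀ {n w} (v : Dyck n) (e : Edge w (word v)) → source v e ⟶ v
source⟶ v e = fromEdge {u = source v e} {v} e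

splitEdge-irreducible : ∀ {m t v} (u : Dyck (suc m)) → Irreducible v → Path 0 t 0 →
                        Edge t (word u ♯ʷ v) → SplitEdge t (word u) v
splitEdge-irreducible u (isBump refl) pt e with word u | peak u | toPath u
... | _ | []    , k , refl | pu = splitEdge-1010 pu pt e
... | _ | _ ∷ _ , k , refl | pu = splitEdge-1010 pu pt e
splitEdge-irreducible u (isArch pw refl) pt e with word u | peak u | toPath u
... | _ | s , k , refl | pu = splitEdge-arch pu pw pt e

-- Induction over the factors of `v = p ♯ g`: reassociated, the edge goes into `(u ♯ p) ♯ g` and
-- splits at the irreducible `g`; an edge into `u ♯ p` is split recursively.
splitEdge : ∀ {m n t} (u : Dyck (suc m)) {v : Dyck (suc n)} → Factors v → Path 0 t 0 →
            Edge t (word u ♯ʷ word v) → SplitEdge t (word u) (word v)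
splitEdge u [] pt e with e′ ← subst (Edge _) (♯ʷ-identityʳ u) e =
  onLeft e′ (sym (♯ʷ-identityʳ (source u e′)))
splitEdge u (_▸_ {u = p} {g} fs irr) pt e
  with splitEdge-irreducible (u ♯ p) irr pt (subst (Edge _) (sym (♯ʷ-assoc u p g)) e)
... | onRight eg refl = onRight
  (toEdge {u = p ♯ source g eg} {p ♯ g} (edge-♯ʳ p {source g eg} {g} (source⟶ g eg)))
  (♯ʷ-assoc u p (source g eg))
... | onLeft eup refl with splitEdge u fs (toPath (source (u ♯ p) eup)) eup
...   | onLeft eu refl  = onLeft eu (♯ʷ-assoc (source u eu) p g)
...   | onRight ep refl = onRight
  (toEdge {u = source p ep ♯ g} {p ♯ g} (edge-♯ˡ {u = source p ep} {p} g (source⟶ p ep)))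
  (♯ʷ-assoc u (source p ep) g)

-- The chain is followed from its top downwards; each edge into the current product extends the
-- chain of one factor.
split-≼ : ∀ {l m n} {t y : Dyck l} (u : Dyck (suc m)) (v : Dyck (suc n)) → t ≼ y →
          word y ≡ word u ♯ʷ word v →
          ∃₂ λ u′ v′ → word t ≡ word u′ ♯ʷ word v′ × u′ ≼ u × v′ ≼ v
split-≼ u v ε eq = u , v , eq , ε , ε
split-≼ {t = t} u v (_◅_ {j = y} e es) eq with split-≼ u v es eq
... | u₁ , v₁ , eq₁ , us , vs
  with splitEdge u₁ (factors v₁) (toPath t) (subst (Edge _) eq₁ (toEdge {u = t} {y} e))
... | onLeft eu eq₂  = source u₁ eu , v₁ , eq₂ , source⟶ u₁ eu ◅ us , vs
... | onRight ev eq₂ = u₁ , source v₁ ev , eq₂ , us , source⟶ v₁ ev ◅ vs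

-- A single zero after the last peak forces an edge into `1 0`, but targets of edges contain two
-- letters 1.
¬edge-bump : ∀ {t} → Path 0 t 0 → ¬ Edge t (word ⟨1010⟩)
¬edge-bump pt e with peakSource (𝟏 ∷ 𝟎 ∷ []) 1 e pt refl
... | precedes t′ e′ _ = onePeak e′ refl
  where
  onePeak : ∀ {t t′} → Edge t t′ → t′ ≢ 𝟏 ∷ 𝟎 ∷ []
  onePeak (edge []      j i d b _ _) eq = 𝟏∉zeros 1 (𝟎^ j) (sym (∷-injectiveʳ eq))
  onePeak (edge (_ ∷ c) j i d b _ _) eq = 𝟏∉zeros 1 c (sym (∷-injectiveʳ eq))

≼-bump : ∀ {n} {u v : Dyck n} → u ≼ v → word v ≡ word ⟨1010⟩ → word u ≡ word ⟨1010⟩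
≼-bump ε eq = eq
≼-bump {u = u} (_◅_ {j = y} e es) eq =
  contradiction (subst (Edge _) (≼-bump es eq) (toEdge {u = u} {y} e)) (¬edge-bump (toPath u))

word-Dyck-1 : ∀ (u : Dyck 1) → word u ≡ word ⟨10⟩
word-Dyck-1 u with word u | Dyck.#𝟏-word u | return u
... | _ | eq | q , r , refl , pq , pr with followedP pq | followedP pr
... | inj₁ refl         | inj₁ refl         = refl
... | inj₁ refl         | inj₂ (_ , refl) with () ← eq
... | inj₂ (_ , refl)   | _               with () ← eq

Irreducible⇒Generator : ∀ {n} {u v : Dyck (suc n)} (p : u ≼ v) →
                        Irreducible (word v) → Generator ⟨ u , v , p ⟩
Irreducible⇒Generator p (isBump e)        = inj₂ (≼-bump p e , e)
Irreducible⇒Generator p (isArch {w} pw e) = inj₁ (_ , fromPath w pw refl , e)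

-- Evaluation and its surjectivity.

open Monoid 𝕄₂ using (∙-cong; assoc; identityˡ; identityʳ)
open SetoidReasoning (Monoid.setoid 𝕄₂) using (begin_; step-≈-⟩; step-≈-⟨; _∎)

eval : List (∃ Generator) → Interval
eval = evaluate 𝕄₂ Generator

infix 4 _≋_

_≋_ : List (∃ Generator) → List (∃ Generator) → Set
_≋_ = Pointwise (λ g h → proj₁ g ≈ proj₁ h)

eval-cong : ∀ {xs ys} → xs ≋ ys → eval xs ≈ eval ys
eval-cong []       = refl , refl
eval-cong {(g , _) ∷ xs} {(h , _) ∷ ys} (p ∷ ps) =
  ∙-cong {g} {h} {eval xs} {eval ys} p (eval-cong ps)

eval-++ : ∀ xs ys → eval (xs ++ ys) ≈ eval xs ∙ eval ys
eval-++ []             ys = begin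
  eval ys          ≈⟨ identityˡ (eval ys) ⟨
  unit ∙ eval ys   ∎
eval-++ ((g , _) ∷ xs) ys = begin
  g ∙ eval (xs ++ ys)
    ≈⟨ ∙-cong {g} {g} {eval (xs ++ ys)} {eval xs ∙ eval ys} (refl , refl) (eval-++ xs ys) ⟩
  g ∙ (eval xs ∙ eval ys)
    ≈⟨ assoc g (eval xs) (eval ys) ⟨
  (g ∙ eval xs) ∙ eval ys ∎

-- Induction over the factors of the top: the bottom splits along the last one, which contributes a
-- generator at the end of the list.
eval-surjective : ∀ {n} {u v : Dyck (suc n)} → Factors v → (p : u ≼ v) →
                  ∃ λ xs → eval xs ≈ ⟨ u , v , p ⟩
eval-surjective {u = u} [] p = [] , sym (word-Dyck-1 u) , refl
eval-surjective {u = u} {v} (_▸_ {u = v₁} {v₂} fs irr) p with split-≼ v₁ v₂ p refl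
... | u₁ , u₂ , eq , p₁ , p₂ with eval-surjective fs p₁
... | xs , e = xs ++ gs , (begin
    eval (xs ++ gs)       ≈⟨ eval-++ xs gs ⟩
    eval xs ∙ (g ∙ unit)  ≈⟨ ∙-cong {eval xs} {I} {g ∙ unit} {g} e (identityʳ g) ⟩
    I ∙ g                 ≈⟨ eq , refl ⟨
    ⟨ u , v , p ⟩         ∎)
  where
  I g : Interval
  I = ⟨ u₁ , v₁ , p₁ ⟩
  g = ⟨ u₂ , v₂ , p₂ ⟩

  gs : List (∃ Generator)
  gs = (g , Irreducible⇒Generator p₂ irr) ∷ []

-- Cancellation and injectivity of evaluation.

-- In the product `s 1 q 0ᵏ⁺¹ r`, the size of `u` locates the 1 after `s`. Then `k` is the final
-- height of `s`, `q` ends at the first return, and `r` is what remains.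
♯ʷ-cancel : ∀ {m n m′ n′} (u : Dyck (suc m)) (v : Dyck (suc n)) (u′ : Dyck (suc m′))
            (v′ : Dyck (suc n′)) → m ≡ m′ →
            word u ♯ʷ word v ≡ word u′ ♯ʷ word v′ → word u ≡ word u′ × word v ≡ word v′
♯ʷ-cancel u v u′ v′ em = go (peak u) (toPath u) (return v) (peak u′) (toPath u′) (return v′)
  (trans (Dyck.#𝟏-word u) (trans (cong suc em) (sym (Dyck.#𝟏-word u′))))
  where
  go : ∀ {u v u′ v′} → Peak u → Path 0 u 0 → Return v → Peak u′ → Path 0 u′ 0 → Return v′ →
       #𝟏 u ≡ #𝟏 u′ → u ♯ʷ v ≡ u′ ♯ʷ v′ → u ≡ u′ × v ≡ v′
  go (s , k , refl) pu (q , r , refl , pq , pr) (s′ , k′ , refl) pu′ (q′ , r′ , refl , pq′ , pr′) e eq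
    with #𝟏-prefix-unique s s′
           (trans (sym (♯ʷ-shape s k q r pu pq pr)) (trans eq (♯ʷ-shape s′ k′ q′ r′ pu′ pq′ pr′)))
           (suc-injective (trans (sym (peak-#𝟏 s (suc k))) (trans e (peak-#𝟏 s′ (suc k′)))))
  ... | refl , eq₁ with refl ← det (peakP⁻ s k pu) (peakP⁻ s k′ pu′) | firstReturn-unique pq pq′ eq₁
  ...   | refl , eq₂ with refl ← ++-cancelˡ (𝟎^ k) r r′ eq₂ = refl , refl

-- The first product starts with `1 0`, the second with `1 1`.
bump♯≢arch♯ : ∀ {v v′ w} → Path 0 w 0 → Return v → Return v′ → word ⟨1010⟩ ♯ʷ v ≢ arch w ♯ʷ v′
bump♯≢arch♯ {w = w} pw (q , r , refl , pq , pr) (q′ , r′ , refl , pq′ , pr′) eq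
  with pw | trans (sym (♯ʷ-shape (𝟏 ∷ 𝟎 ∷ []) 0 q r (toPath ⟨1010⟩) pq pr))
                (trans eq (♯ʷ-shape (𝟏 ∷ w) 1 q′ r′ (archP pw) pq′ pr′))
... | nil  | ()
... | up _ | ()

-- For an arch, the product is `1 (w 1 q 0) 0 r`: its first return isolates `w 1 q 0`, and
-- `climb-unique` removes the last prime factor `1 q 0`.
irreducible-unique : ∀ {u u′ v v′} → Irreducible u → Irreducible u′ → Return v → Return v′ →
                     u ♯ʷ v ≡ u′ ♯ʷ v′ → u ≡ u′
irreducible-unique (isBump refl)    (isBump refl)    _ _  _  = refl
irreducible-unique (isBump refl)    (isArch pw refl) v v′ eq = contradiction eq (bump♯≢arch♯ pw v v′)
irreducible-unique (isArch pw refl) (isBump refl)    v v′ eq = contradiction (sym eq) (bump♯≢arch♯ pw v′ v)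
irreducible-unique (isArch {w} pw refl) (isArch {w′} pw′ refl)
                   (q , r , refl , pq , pr) (q′ , r′ , refl , pq′ , pr′) eq
  with firstReturn-unique (pw ⊙ factorP pq) (pw′ ⊙ factorP pq′)
         (∷-injectiveʳ (trans (sym (shape w q r pw pq pr)) (trans eq (shape w′ q′ r′ pw′ pq′ pr′))))
  where
  shape : ∀ w q r → Path 0 w 0 → Path 0 q 0 → Path 0 r 0 →
          arch w ♯ʷ (𝟏 ∷ q ++ 𝟎 ∷ r) ≡ 𝟏 ∷ (w ++ 𝟏 ∷ q ++ 𝟎 ∷ []) ++ 𝟎 ∷ r
  shape w q r pw pq pr = trans (♯ʷ-shape (𝟏 ∷ w) 1 q r (archP pw) pq pr)
    (solve 5 (λ o w q z r → (o ⊕ w) ⊕ (o ⊕ q) ⊕ (z ⊕ z) ⊕ r ⊜ (o ⊕ (w ⊕ (o ⊕ q) ⊕ z)) ⊕ z ⊕ r)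
      refl (𝟏 ∷ []) w q (𝟎 ∷ []) r)
... | eq₁ , _ with climb-unique w w′ (∷ʳ-injectiveˡ (w ++ 𝟏 ∷ q) (w′ ++ 𝟏 ∷ q′)
                     (trans (++-assoc w _ _) (trans eq₁ (sym (++-assoc w′ _ _))))) pq pq′
... | refl , _ = refl

pred-size-unique : ∀ {m n m′ n′} (u : Dyck (suc m)) (v : Dyck (suc n))
                   (u′ : Dyck (suc m′)) (v′ : Dyck (suc n′)) →
                   Irreducible (word u) → Irreducible (word u′) →
                   word u ♯ʷ word v ≡ word u′ ♯ʷ word v′ → m ≡ m′
pred-size-unique u v u′ v′ irr irr′ eq =
  suc-injective (trans (sym (Dyck.#𝟏-word u))
    (trans (cong #𝟏 (irreducible-unique irr irr′ (return v) (return v′) eq)) (Dyck.#𝟏-word u′)))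

unit-indecomposable : ∀ {m n} (u : Dyck (suc m)) (v : Dyck (suc n)) → Irreducible (word u) →
                      word u ♯ʷ word v ≢ word ⟨10⟩
unit-indecomposable u v irr eq with irreducible-pred-size u irr | trans (sym (♯ʷ-#𝟏 u v)) (cong #𝟏 eq)
... | s≤s _ | ()

eval-injective : ∀ xs ys → eval xs ≈ eval ys → xs ≋ ys
eval-injective []             []             _       = []
eval-injective []             ((h , H) ∷ ys) (_ , q) =
  contradiction (sym q) (unit-indecomposable (top h) (top (eval ys)) (Generator⇒Irreducible h H))
eval-injective ((g , G) ∷ xs) []             (_ , q) =
  contradiction q (unit-indecomposable (top g) (top (eval xs)) (Generator⇒Irreducible g G))
eval-injective ((g , G) ∷ xs) ((h , H) ∷ ys) (p , q)
  -- The tops show that the first generators have equal size; with this, bottoms and tops cancel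
  -- alike.
  with e ← pred-size-unique (top g) (top (eval xs)) (top h) (top (eval ys))
             (Generator⇒Irreducible g G) (Generator⇒Irreducible h H) q
  with ♯ʷ-cancel (bottom g) (bottom (eval xs)) (bottom h) (bottom (eval ys)) e p
     | ♯ʷ-cancel (top g) (top (eval xs)) (top h) (top (eval ys)) e q
... | p₁ , p₂ | q₁ , q₂ = (p₁ , q₁) ∷ eval-injective xs ys (p₂ , q₂)

proposition4p2 : IsFreeOn 𝕄₂ Generator
proposition4p2 = record
  { isMonoidMonomorphism = record
    { isMonoidHomomorphism = record
      { isMagmaHomomorphism = record
        { isRelHomomorphism = record { cong = eval-cong }
        ; homo = eval-++
        }
      ; ε-homo = refl , refl
      }
    ; injective = λ {xs} {ys} → eval-injective xs ys
    }
  ; surjective = λ I →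
      let xs , e = eval-surjective (factors (top I)) (bottom≼top I)
      in xs , λ {zs} zs≋xs → begin
        eval zs   ≈⟨ eval-cong zs≋xs ⟩
        eval xs   ≈⟨ e ⟩
        I         ∎
  }
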